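{- Let $N\ge 2$ and let $$\mathcal Q_N=\{\pi_{a,b}(X)=aX^2+bX\in\mathbb Z_N[X]:\ \pi_{a,b}\text{ permutes }\mathbb Z_N,\ a\not\equiv 0\pmod N\}.$$ Then the following are equivalent: (1) $\mathcal Q_N\neq\varnothing$ and, for every $\pi\in\mathcal Q_N$, every $u\in\mathbb Z$ with $\gcd(u,N)=1$ and every $q\in\mathbb Z$, the sequence $k\mapsto z_{u,q,N}(\pi(k))$ on $\mathbb Z_N$ is inequivalent to every Zadoff--Chu sequence; (2) $N$ is odd, $9\nmid N$, and there exists a prime $p\ge5$ with $p^2\mid N$. In particular, $N=75=3\cdot 5^2$ satisfies (2) but is not a prime power; hence $N=75$ is a counterexample to the assertion that (1) holds only if $N=p^n$ with $p>3$ prime and $n>1$.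
   Context: Write $\mathbb Z_N=\mathbb Z/N\mathbb Z$, $\zeta_N=\exp(-\pi\sqrt{ -1}/N)$, $W_N=\zeta_N^2=\exp(-2\pi\sqrt{ -1}/N)$, and $\varepsilon_N=N\bmod 2\in\{0,1\}$. For $u\in\mathbb Z$ with $\gcd(u,N)=1$ and $q\in\mathbb Z$, the length-$N$ Zadoff--Chu sequence is $z_{u,q,N}(t)=\zeta_N^{u(t+\varepsilon_N+2q)t}$; this depends only on $t$ modulo $N$, so it is a function on $\mathbb Z_N$. Equivalence is under the five operations on sequences $s:\mathbb Z_N\to\mathbb C$: $s(k)\mapsto c\,s(k)$ with $|c|=1$; $s(k)\mapsto s(k+d)$ with $d\in\mathbb Z_N$; $s(k)\mapsto s(rk)$ with $r\in\mathbb Z_N^\times$; $s(k)\mapsto W_N^{\lambda k}s(k)$ with $\lambda\in\mathbb Z_N$; $s(k)\mapsto\overline{s(k)}$. Equivalently, a sequence $s$ on $\mathbb Z_N$ is equivalent to a Zadoff--Chu sequence if there exist $\sigma\in\{\pm1\}$, $r\in\mathbb Z_N^\times$, $d,\lambda\in\mathbb Z_N$, $u'$ coprime to $N$, $q'$, and a unimodular constant $c$ such that $s(k)=c\,W_N^{\lambda k}\,\zeta_N^{\sigma u'(rk+d+\varepsilon_N+2q')(rk+d)}$ for all $k\in\mathbb Z_N$. -}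

module Defs where

open import Level using (Level; _⊔_) renaming (suc to lsuc)
open import Algebra.Apartness.Bundles using (HeytingField)
open import Algebra.Bundles using (CommutativeRing)
open import Algebra.Definitions using (Invertible)
import Algebra.Definitions.RawMonoid as Multiple
open import Data.Nat.Base as ℕ using (ℕ; zero; suc)
open import Data.Nat.DivMod using (_%_)
open import Data.Nat.Divisibility using (_∣_)
open import Data.Nat.Primality using (Prime)
open import Data.Integer.Base as ℤ using (ℤ; +_; -[1+_]; 0ℤ; 1ℤ)
open import Data.Integer.DivMod using (_%ℕ_; n%ℕd<d)
open import Data.Integer.GCD using (gcd)
open import Data.Fin.Base using (Fin; toℕ; fromℕ<)
open import Data.Product.Base using (∃-syntax; ∃₂; _×_; _,_; proj₁; proj₂)
open import Data.Sum.Base using (_⊎_)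
open import Function.Base using (_∘_)
open import Function.Definitions using (Bijective)
open import Relation.Binary.Core using (Rel)
open import Relation.Binary.Structures using (IsStrictPartialOrder)
open import Relation.Binary.Construct.Closure.ReflexiveTransitive using (Star)
open import Relation.Binary.PropositionalEquality.Core using (_≡_; _≢_)
open import Relation.Nullary.Negation.Core using (¬_)

-- The real numbers, up to isomorphism: an Archimedean, Cauchy-complete
-- ordered field, in the constructive (Heyting) form with apartness.

record RealNumbers (c ℓ₁ ℓ₂ ℓ₃ : Level) : Set (lsuc (c ⊔ ℓ₁ ⊔ ℓ₂ ⊔ ℓ₃)) where
  infix 4 _<_
  field
    heytingField : HeytingField c ℓ₁ ℓ₂

  open HeytingField heytingField public

  commutativeRing : CommutativeRing c ℓ₁
  commutativeRing = record { isCommutativeRing = isCommutativeRing }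

  fromℕ : ℕ → Carrier
  fromℕ n = Multiple._×_ (CommutativeRing.+-rawMonoid commutativeRing) n 1#

  field
    _<_                    : Rel Carrier ℓ₃
    <-isStrictPartialOrder : IsStrictPartialOrder _≈_ _<_
    #⇒<⊎>                  : ∀ {x y} → x # y → x < y ⊎ y < x
    <⇒#                    : ∀ {x y} → x < y → x # y
    0<1                    : 0# < 1#
    +-monoˡ-<              : ∀ {x y} z → x < y → x + z < y + z
    *-pos                  : ∀ {x y} → 0# < x → 0# < y → 0# < x * y
    archimedean            : ∀ x → ∃[ n ] x < fromℕ n

  Cauchy : (ℕ → Carrier) → Set (c ⊔ ℓ₃)
  Cauchy f = ∀ ε → 0# < ε →
    ∃[ M ] ∀ m n → M ℕ.≤ m → M ℕ.≤ n → f m < f n + ε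

  _ConvergesTo_ : (ℕ → Carrier) → Carrier → Set (c ⊔ ℓ₃)
  f ConvergesTo l = ∀ ε → 0# < ε →
    ∃[ M ] ∀ n → M ℕ.≤ n → f n < l + ε × l < f n + ε

  field
    complete : ∀ f → Cauchy f → ∃[ l ] f ConvergesTo l

  private
    module < = IsStrictPartialOrder <-isStrictPartialOrder

  fromℕ-pos : ∀ n → 0# < fromℕ (suc n)
  fromℕ-pos zero    = <.<-respʳ-≈ (sym (+-identityʳ 1#)) 0<1
  fromℕ-pos (suc n) = <.trans (fromℕ-pos n)
    (<.<-respˡ-≈ (+-identityˡ _) (+-monoˡ-< (fromℕ (suc n)) 0<1))

  fromℕ-invertible : ∀ n .{{_ : ℕ.NonZero n}} →
                     Invertible _≈_ 1# _*_ (fromℕ n - 0#)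
  fromℕ-invertible (suc n) = #⇒invertible (#-sym (<⇒# (fromℕ-pos n)))

  infixl 7 _/ℕ_

  _/ℕ_ : Carrier → (n : ℕ) → .{{_ : ℕ.NonZero n}} → Carrier
  x /ℕ n = x * proj₁ (fromℕ-invertible n)

-- π, cos and sin, uniquely determined by the four properties used as
-- their definition in Apostol, Calculus I, §2.5.  The last three fields
-- are 0 < cos x < sin x / x < 1 / cos x with denominators cleared.

record Trigonometry {c ℓ₁ ℓ₂ ℓ₃} (ℝ : RealNumbers c ℓ₁ ℓ₂ ℓ₃) :
                    Set (c ⊔ ℓ₁ ⊔ ℓ₃) where
  open RealNumbers ℝ
  field
    π        : Carrier
    cos sin  : Carrier → Carrier
    0<π      : 0# < π
    cos-cong : ∀ {x y} → x ≈ y → cos x ≈ cos y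
    sin-cong : ∀ {x y} → x ≈ y → sin x ≈ sin y
    cos-0    : cos 0# ≈ 1#
    sin-π/2  : sin (π /ℕ 2) ≈ 1#
    cos-π    : cos π ≈ - 1#
    cos-sub  : ∀ x y → cos (y - x) ≈ cos y * cos x + sin y * sin x
    0<cos    : ∀ x → 0# < x → x < π /ℕ 2 → 0# < cos x
    cos<sin/ : ∀ x → 0# < x → x < π /ℕ 2 → x * cos x < sin x
    sin/<sec : ∀ x → 0# < x → x < π /ℕ 2 → sin x * cos x < x

module Complex {c ℓ₁ ℓ₂ ℓ₃} {ℝ : RealNumbers c ℓ₁ ℓ₂ ℓ₃}
               (T : Trigonometry ℝ) where
  open RealNumbers ℝ
  open Trigonometry T

  infix  4 _≈ᶜ_
  infixl 7 _*ᶜ_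
  infixr 8 _^ℕ_ _^ᶜ_

  record ℂ : Set c where
    constructor _+i_
    field
      re im : Carrier
  open ℂ public

  _≈ᶜ_ : Rel ℂ ℓ₁
  z ≈ᶜ w = re z ≈ re w × im z ≈ im w

  1ᶜ : ℂ
  1ᶜ = 1# +i 0#

  _*ᶜ_ : ℂ → ℂ → ℂ
  z *ᶜ w = (re z * re w - im z * im w) +i (re z * im w + im z * re w)

  conj : ℂ → ℂ
  conj z = re z +i (- im z)

  -- |z| = 1, stated as |z|² = 1
  Unimodular : ℂ → Set ℓ₁
  Unimodular z = re z * re z + im z * im z ≈ 1#

  _^ℕ_ : ℂ → ℕ → ℂ
  z ^ℕ zero  = 1ᶜ
  z ^ℕ suc n = z *ᶜ (z ^ℕ n)

  -- Integer powers of a unimodular number, whose inverse is its conjugate;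
  -- not the integer power for other z.
  _^ᶜ_ : ℂ → ℤ → ℂ
  z ^ᶜ (+ n)    = z ^ℕ n
  z ^ᶜ -[1+ n ] = conj z ^ℕ suc n

  -- exp(θ√-1), by Euler's formula
  exp-i : Carrier → ℂ
  exp-i θ = cos θ +i sin θ

-- ℤ/Nℤ, represented by the least nonnegative residues

module Residues (N : ℕ) .{{_ : ℕ.NonZero N}} where
  infixl 6 _⊕_
  infixl 7 _⊗_

  ℤ/N : Set
  ℤ/N = Fin N

  residue : ℤ → ℤ/N
  residue m = fromℕ< (n%ℕd<d m N)

  repr : ℤ/N → ℤ
  repr k = + toℕ k

  _⊕_ _⊗_ : ℤ/N → ℤ/N → ℤ/N
  j ⊕ k = residue (repr j ℤ.+ repr k)
  j ⊗ k = residue (repr j ℤ.* repr k)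

  IsUnit : ℤ/N → Set
  IsUnit r = Invertible _≡_ (residue 1ℤ) _⊗_ r

  quadratic : ℤ/N → ℤ/N → ℤ/N → ℤ/N
  quadratic a b x = a ⊗ (x ⊗ x) ⊕ b ⊗ x

  -- (a , b) stands for the polynomial aX² + bX.
  𝒬 : ℤ/N → ℤ/N → Set
  𝒬 a b = Bijective _≡_ _≡_ (quadratic a b) × a ≢ residue 0ℤ

module Sequences {c ℓ₁ ℓ₂ ℓ₃} {ℝ : RealNumbers c ℓ₁ ℓ₂ ℓ₃}
                 (T : Trigonometry ℝ) (N : ℕ) .{{_ : ℕ.NonZero N}} where
  open RealNumbers ℝ using (-_; _/ℕ_)
  open Trigonometry T using (π)
  open Complex T
  open Residues N

  infix 4 _↝_ _~_

  Sequence : Set c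
  Sequence = ℤ/N → ℂ

  ζ W : ℂ
  ζ = exp-i (- (π /ℕ N))
  W = ζ ^ᶜ (+ 2)

  -- The value at t ∈ ℤ depends only on t mod N, so the least residue serves.
  zadoffChu : (u q : ℤ) → Sequence
  zadoffChu u q k = ζ ^ᶜ (u ℤ.* (t ℤ.+ + (N % 2) ℤ.+ + 2 ℤ.* q) ℤ.* t)
    where
    t : ℤ
    t = repr k

  data _↝_ (s s′ : Sequence) : Set (c ⊔ ℓ₁) where
    scale     : ∀ z → Unimodular z →
                (∀ k → s′ k ≈ᶜ z *ᶜ s k) → s ↝ s′
    shift     : ∀ d →
                (∀ k → s′ k ≈ᶜ s (k ⊕ d)) → s ↝ s′
    decimate  : ∀ r → IsUnit r →
                (∀ k → s′ k ≈ᶜ s (r ⊗ k)) → s ↝ s′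
    modulate  : ∀ l →
                (∀ k → s′ k ≈ᶜ (W ^ᶜ (repr l ℤ.* repr k)) *ᶜ s k) → s ↝ s′
    conjugate : (∀ k → s′ k ≈ᶜ conj (s k)) → s ↝ s′

  -- Symmetric as well, since each operation is undone by one of its own kind.
  _~_ : Rel Sequence (c ⊔ ℓ₁)
  _~_ = Star _↝_

  InequivalentToEveryZadoffChu : Sequence → Set (c ⊔ ℓ₁)
  InequivalentToEveryZadoffChu s =
    ∀ u q → gcd u (+ N) ≡ 1ℤ → ¬ (s ~ zadoffChu u q)

  AllQuadraticsInequivalent : Set (c ⊔ ℓ₁)
  AllQuadraticsInequivalent =
      (∃₂ λ a b → 𝒬 a b)
    × (∀ a b → 𝒬 a b → ∀ u → gcd u (+ N) ≡ 1ℤ → ∀ q →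
         InequivalentToEveryZadoffChu (zadoffChu u q ∘ quadratic a b))

ArithmeticCondition : ℕ → Set
ArithmeticCondition N =
    ¬ (2 ∣ N)
  × ¬ (9 ∣ N)
  × (∃[ p ] Prime p × 5 ℕ.≤ p × p ℕ.^ 2 ∣ N)

PrimePower : ℕ → Set
PrimePower N = ∃₂ λ p n → Prime p × 1 ℕ.≤ n × N ≡ p ℕ.^ n

{-# OPTIONS --safe #-}

-- For odd N, every sequence equivalent to a Zadoff–Chu sequence is a chirp
-- k ↦ z W^(αk² + βk).  If z_{u,q,N} ∘ π is a chirp, then, ζ being a primitive
-- 2N-th root of unity, the third and fourth differences of its quartic phase
-- vanish mod N, so that N divides 24ua² and 36ua² + 12uab.  A quadratic
-- permutation has p ∣ a and p ∤ b for every odd prime p ∣ N; together with 9 ∤ N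
-- this forces N ∣ a.  Conversely, π = (N/2)X² + (1 − N/2)X is the identity when N
-- is even, π = (N/3)X² + X carries one Zadoff–Chu sequence to another when N is
-- odd and 9 ∣ N, and any prime p ∣ N / gcd(a, N) divides a, whence p² ∣ N.

module Submission where

open import Defs
open import Algebra.Bundles using (CommutativeMonoid; CommutativeRing)
open import Data.Nat.Base as ℕ using (ℕ; zero; suc; NonZero)
import Data.Nat.Properties as ℕ
open import Data.Integer.Base as ℤ using (ℤ; +_; -[1+_]; 0ℤ; 1ℤ; -1ℤ)
import Data.Integer.Properties as ℤ
open import Data.Integer.DivMod using (_%ℕ_; n%ℕd<d; a≡a%ℕn+[a/ℕn]*n) renaming (_/ℕ_ to _/ℕ′_)
open import Data.Integer.Divisibility.Signed
  using (_∣_; divides; ∣⇒∣ᵤ; ∣ᵤ⇒∣; ∣-trans; ∣m⇒∣-m; ∣m∣n⇒∣m+n; ∣m+n∣m⇒∣n; ∣n⇒∣m*n; ∣m⇒∣m*n)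
open import Data.Integer.Tactic.RingSolver using (solve-∀)
open import Data.Product.Base using (_×_; _,_; proj₁; proj₂; ∃; ∃-syntax; ∃₂)
open import Data.Sum.Base using (inj₁; inj₂; [_,_]′)
open import Function.Bundles using (_⇔_; mk⇔)
open import Relation.Binary.Definitions using (tri<; tri≈; tri>)
import Relation.Binary.PropositionalEquality as ≡
open import Relation.Binary.Structures using (IsStrictPartialOrder)
open import Relation.Nullary.Negation.Core using (¬_; contradiction)
open import Data.Nat.Primality
  using (Prime; euclidsLemma; prime?; prime⇒irreducible; prime⇒nonTrivial; prime[2]; ¬prime[0]; ¬prime[1])

-- Two moduli compete. ζ has order 2N, whereas replacing an integer by its least residue preserves
-- congruence modulo N only. For odd N the Zadoff-Chu exponent is even, so ζ can be traded for W, of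
-- period N, and the comparison of phases descends to N. The identity behind the case 9 ∣ N must
-- hold modulo 2N, and its extra factor 2 comes from products of consecutive integers. Differences
-- replace the comparison of coefficients because the phase is known only as a function on residues,
-- and polynomials that agree modulo N as functions need not have congruent coefficients. The price
-- is the factor 24, whose odd part 3 is the one obstruction: with 2, u and b invertible, the
-- differences yield N ∣ 3a and no more. A nonzero a can survive this only if 9 ∣ N, and a = N/3 is
-- such a survivor, which is where the polynomial for that case comes from.

-- The ordered field of real numbers

module RealProperties {c ℓ₁ ℓ₂ ℓ₃} (ℝ : RealNumbers c ℓ₁ ℓ₂ ℓ₃) where
  open RealNumbers ℝ
  module R = CommutativeRing commutativeRing
  open import Algebra.Properties.Ring R.ring public
  open import Algebra.Properties.Monoid.Mult R.+-monoid public
    using () renaming (_×_ to _·_; ×-congʳ to ·-congʳ; ×-homo-+ to ·-homo-+)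
  open import Algebra.Properties.CommutativeMonoid.Mult R.+-commutativeMonoid public
    using () renaming (×-distrib-+ to ·-distrib-+)
  open import Algebra.Properties.Semiring.Mult R.semiring public
    using () renaming (×-assoc-* to ·-assoc-*)
  open import Relation.Binary.Reasoning.Setoid R.setoid
  module < = IsStrictPartialOrder <-isStrictPartialOrder

  x-0≈x : ∀ x → x - 0# ≈ x
  x-0≈x x = trans (+-congˡ -0#≈0#) (+-identityʳ x)

  x-x-y≈y : ∀ x y → x - (x - y) ≈ y
  x-x-y≈y x y = begin
    x - (x - y)        ≈⟨ +-congˡ (sym (-‿+-comm x (- y))) ⟩
    x + (- x - - y)    ≈⟨ sym (+-assoc x (- x) (- - y)) ⟩
    (x - x) - - y      ≈⟨ +-cong (-‿inverseʳ x) (-‿involutive y) ⟩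
    0# + y             ≈⟨ +-identityˡ y ⟩
    y                  ∎

  -- The reals carry an apartness, so the conclusion comes by tightness: were x apart from 0, its
  -- inverse would cancel one factor of x² ≈ 0.
  square≈0 : ∀ {x} → x * x ≈ 0# → x ≈ 0#
  square≈0 {x} x²≈0 = proj₁ (tight x 0#) x¬#0
    where
    x¬#0 : ¬ (x # 0#)
    x¬#0 x#0 with y , _ , xy≈1 ← #⇒invertible x#0 = proj₂ (tight x 0#) x≈0 x#0
      where
      x≈0 : x ≈ 0#
      x≈0 = begin
        x                  ≈⟨ sym (*-identityʳ x) ⟩
        x * 1#             ≈⟨ *-congˡ (sym xy≈1) ⟩
        x * ((x - 0#) * y) ≈⟨ sym (*-assoc x (x - 0#) y) ⟩
        (x * (x - 0#)) * y ≈⟨ *-congʳ (*-congˡ (x-0≈x x)) ⟩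
        (x * x) * y        ≈⟨ *-congʳ x²≈0 ⟩
        0# * y             ≈⟨ zeroˡ y ⟩
        0#                 ∎

  +-pos : ∀ {x y} → 0# < x → 0# < y → 0# < x + y
  +-pos {x} {y} 0<x 0<y = <.trans 0<y (<.<-respˡ-≈ (+-identityˡ y) (+-monoˡ-< y 0<x))

  ·-pos : ∀ {x} n → 0# < x → 0# < suc n · x
  ·-pos {x} zero    0<x = <.<-respʳ-≈ (sym (+-identityʳ x)) 0<x
  ·-pos     (suc n) 0<x = +-pos 0<x (·-pos n 0<x)

  x<x+y : ∀ x {y} → 0# < y → x < x + y
  x<x+y x {y} 0<y = <.<-respʳ-≈ (+-comm y x) (<.<-respˡ-≈ (+-identityˡ x) (+-monoˡ-< x 0<y))

  ·-monoˡ-< : ∀ {x m n} → 0# < x → m ℕ.< n → m · x < n · x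
  ·-monoˡ-< {x} {m} 0<x m<n with k , ≡.refl ← ℕ.m≤n⇒∃[o]m+o≡n m<n =
    <.<-respʳ-≈ (trans (sym (·-homo-+ x m (suc k))) (reflexive (≡.cong (_· x) (ℕ.+-suc m k))))
      (x<x+y (m · x) (·-pos k 0<x))

  ·-neg : ∀ n x → n · (- x) ≈ - (n · x)
  ·-neg zero    x = sym -0#≈0#
  ·-neg (suc n) x = trans (+-congˡ (·-neg n x)) (-‿+-comm x (n · x))

  fromℕ-* : ∀ n x → fromℕ n * x ≈ n · x
  fromℕ-* n x = trans (·-assoc-* n 1# x) (·-congʳ n (*-identityˡ x))

  /ℕ-inverse : ∀ n .{{_ : NonZero n}} x → n · (x /ℕ n) ≈ x
  /ℕ-inverse n x with y , _ , ny≈1 ← fromℕ-invertible n = begin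
    n · (x * y)             ≈⟨ sym (fromℕ-* n (x * y)) ⟩
    fromℕ n * (x * y)       ≈⟨ *-congˡ (*-comm x y) ⟩
    fromℕ n * (y * x)       ≈⟨ sym (*-assoc (fromℕ n) y x) ⟩
    (fromℕ n * y) * x       ≈⟨ *-congʳ (*-congʳ (sym (x-0≈x (fromℕ n)))) ⟩
    ((fromℕ n - 0#) * y) * x ≈⟨ *-congʳ ny≈1 ⟩
    1# * x                  ≈⟨ *-identityˡ x ⟩
    x                       ∎

  -- Invertibility makes y apart from 0, and y < 0 would give 0 < x (- y) ≈ - 1, hence 0 < 1 - 1.
  inverse-pos : ∀ {x y} → 0# < x → x * y ≈ 1# → 0# < y
  inverse-pos {x} {y} 0<x xy≈1 with #⇒<⊎> (invertible⇒# {y} {0#}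
    (x , trans (*-congˡ (x-0≈x y)) xy≈1 , trans (*-congʳ (x-0≈x y)) (trans (*-comm y x) xy≈1)))
  ... | inj₂ 0<y = 0<y
  ... | inj₁ y<0 = contradiction
    (<.<-respʳ-≈ (trans (+-congˡ x[-y]≈-1) (-‿inverseʳ 1#)) (+-pos 0<1 (*-pos 0<x 0<-y)))
    (<.irrefl refl)
    where
    0<-y : 0# < - y
    0<-y = <.<-respʳ-≈ (+-identityˡ (- y)) (<.<-respˡ-≈ (-‿inverseʳ y) (+-monoˡ-< (- y) y<0))
    x[-y]≈-1 : x * - y ≈ - 1#
    x[-y]≈-1 = trans (sym (-‿distribʳ-* x y)) (-‿cong xy≈1)

  /ℕ-pos : ∀ {x} n .{{_ : NonZero n}} → 0# < x → 0# < x /ℕ n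
  /ℕ-pos (suc n) 0<x with y , _ , ny≈1 ← fromℕ-invertible (suc n) =
    *-pos 0<x (inverse-pos (fromℕ-pos n) (trans (*-congʳ (sym (x-0≈x _))) ny≈1))

  halves : ∀ x → x /ℕ 2 + x /ℕ 2 ≈ x
  halves x = trans (+-congˡ (sym (+-identityʳ _))) (/ℕ-inverse 2 x)

  half-unique : ∀ {x y} → x + x ≈ y + y → x ≈ y
  half-unique {x} {y} 2x≈2y = begin
    x                     ≈⟨ sym (/ℕ2 x) ⟩
    (x + x) /ℕ 2          ≈⟨ *-congʳ 2x≈2y ⟩
    (y + y) /ℕ 2          ≈⟨ /ℕ2 y ⟩
    y                     ∎
    where
    /ℕ2 : ∀ x → (x + x) /ℕ 2 ≈ x
    /ℕ2 x = trans (distribʳ _ x x) (halves x)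

  1≉-1 : ¬ (1# ≈ - 1#)
  1≉-1 1≈-1 = <.irrefl refl (<.<-respʳ-≈ (trans (+-congˡ 1≈-1) (-‿inverseʳ 1#)) (+-pos 0<1 0<1))

-- Trigonometric identities and the sign of the sine

module TrigonometryProperties {c ℓ₁ ℓ₂ ℓ₃} {ℝ : RealNumbers c ℓ₁ ℓ₂ ℓ₃}
                              (T : Trigonometry ℝ) where
  open RealNumbers ℝ
  open RealProperties ℝ
  open Trigonometry T
  open import Relation.Binary.Reasoning.Setoid R.setoid

  private
    π/2 : Carrier
    π/2 = π /ℕ 2

  cos²+sin² : ∀ x → cos x * cos x + sin x * sin x ≈ 1#
  cos²+sin² x = begin
    cos x * cos x + sin x * sin x ≈⟨ sym (cos-sub x x) ⟩
    cos (x - x)                   ≈⟨ cos-cong (-‿inverseʳ x) ⟩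
    cos 0#                        ≈⟨ cos-0 ⟩
    1#                            ∎

  -- The axioms fix cos at 0 and π and sin at π/2; the Pythagorean identity supplies the companion
  -- values, each as a number whose square vanishes.
  cos²≈1⇒sin≈0 : ∀ x → cos x * cos x ≈ 1# → sin x ≈ 0#
  cos²≈1⇒sin≈0 x cos²≈1 = square≈0 (+-identityʳ-unique 1# _
    (trans (+-congʳ (sym cos²≈1)) (cos²+sin² x)))

  sin-0 : sin 0# ≈ 0#
  sin-0 = cos²≈1⇒sin≈0 0# (trans (*-cong cos-0 cos-0) (*-identityˡ 1#))

  sin-π : sin π ≈ 0#
  sin-π = cos²≈1⇒sin≈0 π (begin
    cos π * cos π   ≈⟨ *-cong cos-π cos-π ⟩
    - 1# * - 1#     ≈⟨ -1*x≈-x (- 1#) ⟩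
    - - 1#          ≈⟨ -‿involutive 1# ⟩
    1#              ∎)

  cos-π/2 : cos π/2 ≈ 0#
  cos-π/2 = square≈0 (+-identityˡ-unique _ 1#
    (trans (+-congˡ (sym (trans (*-cong sin-π/2 sin-π/2) (*-identityˡ 1#)))) (cos²+sin² π/2)))

  combination : ∀ {a b x y x′ y′} → x ≈ x′ → y ≈ y′ →
                a * x + b * y ≈ a * x′ + b * y′
  combination x≈x′ y≈y′ = +-cong (*-congˡ x≈x′) (*-congˡ y≈y′)

  cos-neg : ∀ x → cos (- x) ≈ cos x
  cos-neg x = begin
    cos (- x)                          ≈⟨ cos-cong (sym (+-identityˡ (- x))) ⟩
    cos (0# - x)                       ≈⟨ cos-sub x 0# ⟩
    cos 0# * cos x + sin 0# * sin x    ≈⟨ +-cong (*-congʳ cos-0) (*-congʳ sin-0) ⟩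
    1# * cos x + 0# * sin x            ≈⟨ +-cong (*-identityˡ _) (zeroˡ _) ⟩
    cos x + 0#                         ≈⟨ +-identityʳ _ ⟩
    cos x                              ∎

  cos[π/2-x] : ∀ x → cos (π/2 - x) ≈ sin x
  cos[π/2-x] x = begin
    cos (π/2 - x)                        ≈⟨ cos-sub x π/2 ⟩
    cos π/2 * cos x + sin π/2 * sin x    ≈⟨ +-cong (*-congʳ cos-π/2) (*-congʳ sin-π/2) ⟩
    0# * cos x + 1# * sin x              ≈⟨ +-cong (zeroˡ _) (*-identityˡ _) ⟩
    0# + sin x                           ≈⟨ +-identityˡ _ ⟩
    sin x                                ∎

  sin[π/2-x] : ∀ x → sin (π/2 - x) ≈ cos x
  sin[π/2-x] x = trans (sym (cos[π/2-x] (π/2 - x))) (cos-cong (x-x-y≈y π/2 x))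

  cos[π-x] : ∀ x → cos (π - x) ≈ - cos x
  cos[π-x] x = begin
    cos (π - x)                      ≈⟨ cos-sub x π ⟩
    cos π * cos x + sin π * sin x    ≈⟨ +-cong (*-congʳ cos-π) (*-congʳ sin-π) ⟩
    - 1# * cos x + 0# * sin x        ≈⟨ +-cong (-1*x≈-x _) (zeroˡ _) ⟩
    - cos x + 0#                     ≈⟨ +-identityʳ _ ⟩
    - cos x                          ∎


  -- Oddness comes from the reflection cos (π - y) = - cos y at y = π/2 - x, where π - y = π/2 - (-
  -- x).
  sin-neg : ∀ x → sin (- x) ≈ - sin x
  sin-neg x = begin
    sin (- x)              ≈⟨ sym (cos[π/2-x] (- x)) ⟩
    cos (π/2 - - x)        ≈⟨ cos-cong (sym π-[π/2-x]) ⟩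
    cos (π - (π/2 - x))    ≈⟨ cos[π-x] (π/2 - x) ⟩
    - cos (π/2 - x)        ≈⟨ -‿cong (cos[π/2-x] x) ⟩
    - sin x                ∎
    where
    π-[π/2-x] : π - (π/2 - x) ≈ π/2 - - x
    π-[π/2-x] = begin
      π - (π/2 - x)             ≈⟨ +-congʳ (sym (halves π)) ⟩
      (π/2 + π/2) - (π/2 - x)   ≈⟨ +-assoc π/2 π/2 _ ⟩
      π/2 + (π/2 - (π/2 - x))   ≈⟨ +-congˡ (x-x-y≈y π/2 x) ⟩
      π/2 + x                   ≈⟨ +-congˡ (sym (-‿involutive x)) ⟩
      π/2 - - x                 ∎

  cos-+ : ∀ x y → cos (x + y) ≈ cos x * cos y - sin x * sin y
  cos-+ x y = begin
    cos (x + y)                              ≈⟨ cos-cong (+-congˡ (sym (-‿involutive y))) ⟩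
    cos (x - - y)                            ≈⟨ cos-sub (- y) x ⟩
    cos x * cos (- y) + sin x * sin (- y)    ≈⟨ combination (cos-neg y) (sin-neg y) ⟩
    cos x * cos y + sin x * - sin y          ≈⟨ +-congˡ (sym (-‿distribʳ-* _ _)) ⟩
    cos x * cos y - sin x * sin y            ∎

  sin-+ : ∀ x y → sin (x + y) ≈ cos x * sin y + sin x * cos y
  sin-+ x y = begin
    sin (x + y)                                       ≈⟨ sym (cos[π/2-x] (x + y)) ⟩
    cos (π/2 - (x + y))                               ≈⟨ cos-cong (+-congˡ (sym (-‿+-comm x y))) ⟩
    cos (π/2 + (- x - y))                             ≈⟨ cos-cong (sym (+-assoc π/2 (- x) (- y))) ⟩
    cos ((π/2 - x) - y)                               ≈⟨ cos-sub y (π/2 - x) ⟩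
    cos (π/2 - x) * cos y + sin (π/2 - x) * sin y     ≈⟨ +-cong (*-congʳ (cos[π/2-x] x)) (*-congʳ (sin[π/2-x] x)) ⟩
    sin x * cos y + cos x * sin y                     ≈⟨ +-comm _ _ ⟩
    cos x * sin y + sin x * cos y                     ∎

  -- The exact order of ζ rests on this sign. The equational axioms alone also hold for x ↦ cos 5x
  -- and x ↦ sin 5x with the same π, and then ζ would have a smaller order whenever 5 ∣ N.
  sin-pos : ∀ {x} → 0# < x → x < π/2 → 0# < sin x
  sin-pos {x} 0<x x<π/2 = <.trans (*-pos 0<x (0<cos x 0<x x<π/2)) (cos<sin/ x 0<x x<π/2)

  -- 1 − cos 2x = 2 sin² x
  cos[x+x]≉1 : ∀ {x} → 0# < x → x < π/2 → ¬ (cos (x + x) ≈ 1#)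
  cos[x+x]≉1 {x} 0<x x<π/2 cos≈1 = <.irrefl (sym (sin²≈0)) (*-pos 0<sin 0<sin)
    where
    0<sin = sin-pos 0<x x<π/2
    s² c² : Carrier
    s² = sin x * sin x
    c² = cos x * cos x
    -s²≈s² : - s² ≈ s²
    -s²≈s² = +-cancelˡ c² (- s²) s² (trans (sym (cos-+ x x)) (trans cos≈1 (sym (cos²+sin² x))))
    sin²≈0 : s² ≈ 0#
    sin²≈0 = half-unique (trans (+-congʳ (sym -s²≈s²))
      (trans (-‿inverseˡ s²) (sym (+-identityˡ 0#))))

-- Complex multiplication and integer powers of unimodular numbers

module ComplexProperties {c ℓ₁ ℓ₂ ℓ₃} {ℝ : RealNumbers c ℓ₁ ℓ₂ ℓ₃}
                         (T : Trigonometry ℝ) where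
  open RealNumbers ℝ
  open RealProperties ℝ
  open Trigonometry T
  open TrigonometryProperties T
  open Complex T
  open import Algebra.Solver.Ring.NaturalCoefficients.Default R.commutativeSemiring
    using (solve; _:=_; _:+_; _:*_)

  private
    sub : ∀ {x y} → x - y ≈ x + - 1# * y
    sub = +-congˡ (sym (-1*x≈-x _))

  *ᶜ-cong : ∀ {z z′ w w′} → z ≈ᶜ z′ → w ≈ᶜ w′ → z *ᶜ w ≈ᶜ z′ *ᶜ w′
  *ᶜ-cong (a , b) (c , d) =
    +-cong (*-cong a c) (-‿cong (*-cong b d)) , +-cong (*-cong a d) (*-cong b c)

  -- Treating −1 as an indeterminate turns this into a semiring identity.
  *ᶜ-assoc : ∀ z w v → (z *ᶜ w) *ᶜ v ≈ᶜ z *ᶜ (w *ᶜ v)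
  *ᶜ-assoc (a +i b) (c +i d) (e +i f) =
      trans (trans sub (+-congʳ (*-congʳ sub))) (trans
        (solve 7 (λ j a b c d e f →
          (a :* c :+ j :* (b :* d)) :* e :+ j :* ((a :* d :+ b :* c) :* f) :=
          a :* (c :* e :+ j :* (d :* f)) :+ j :* (b :* (c :* f :+ d :* e)))
          refl (- 1#) a b c d e f)
        (sym (trans sub (+-congʳ (*-congˡ sub)))))
    , trans (+-congʳ (*-congʳ sub)) (trans
        (solve 7 (λ j a b c d e f →
          (a :* c :+ j :* (b :* d)) :* f :+ (a :* d :+ b :* c) :* e :=
          a :* (c :* f :+ d :* e) :+ b :* (c :* e :+ j :* (d :* f)))
          refl (- 1#) a b c d e f)
        (sym (+-congˡ (*-congˡ sub))))

  *ᶜ-comm : ∀ z w → z *ᶜ w ≈ᶜ w *ᶜ z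
  *ᶜ-comm (a +i b) (c +i d) =
      +-cong (*-comm a c) (-‿cong (*-comm b d))
    , trans (+-comm _ _) (+-cong (*-comm b c) (*-comm a d))

  *ᶜ-identityˡ : ∀ z → 1ᶜ *ᶜ z ≈ᶜ z
  *ᶜ-identityˡ (a +i b) =
      trans (+-cong (*-identityˡ a) (-‿cong (zeroˡ b))) (x-0≈x a)
    , trans (+-cong (*-identityˡ b) (zeroˡ a)) (+-identityʳ b)

  *ᶜ-identityʳ : ∀ z → z *ᶜ 1ᶜ ≈ᶜ z
  *ᶜ-identityʳ (a +i b) =
      trans (+-cong (*-identityʳ a) (-‿cong (zeroʳ b))) (x-0≈x a)
    , trans (+-cong (zeroʳ a) (*-identityʳ b)) (+-identityˡ b)

  *ᶜ-commutativeMonoid : CommutativeMonoid c ℓ₁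
  *ᶜ-commutativeMonoid = record
    { _≈_ = _≈ᶜ_ ; _∙_ = _*ᶜ_ ; ε = 1ᶜ
    ; isCommutativeMonoid = record
      { isMonoid = record
        { isSemigroup = record
          { isMagma = record
            { isEquivalence = record
              { refl  = refl , refl
              ; sym   = λ (p , q) → sym p , sym q
              ; trans = λ (p , q) (p′ , q′) → trans p p′ , trans q q′
              }
            ; ∙-cong = *ᶜ-cong
            }
          ; assoc = *ᶜ-assoc
          }
        ; identity = *ᶜ-identityˡ , *ᶜ-identityʳ
        }
      ; comm = *ᶜ-comm
      }
    }

  open CommutativeMonoid *ᶜ-commutativeMonoid public
    using (commutativeSemigroup)
    renaming (setoid to ℂ-setoid; refl to reflᶜ; sym to symᶜ; trans to transᶜ;
              reflexive to reflexiveᶜ; ∙-congˡ to *ᶜ-congˡ; ∙-congʳ to *ᶜ-congʳ)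
  open import Algebra.Properties.CommutativeSemigroup commutativeSemigroup public
    using () renaming (x∙yz≈y∙xz to *ᶜ-x∙yz≈y∙xz)
  open import Relation.Binary.Reasoning.Setoid ℂ-setoid

  conj-cong : ∀ {z w} → z ≈ᶜ w → conj z ≈ᶜ conj w
  conj-cong (p , q) = p , -‿cong q

  conj-involutive : ∀ z → conj (conj z) ≈ᶜ z
  conj-involutive z = refl , -‿involutive (im z)

  conj-* : ∀ z w → conj (z *ᶜ w) ≈ᶜ conj z *ᶜ conj w
  conj-* (a +i b) (c +i d) =
      +-congˡ (-‿cong (sym (trans (sym (-‿distribˡ-* b (- d)))
        (trans (-‿cong (sym (-‿distribʳ-* b d))) (-‿involutive (b * d))))))
    , trans (sym (-‿+-comm (a * d) (b * c))) (+-cong (-‿distribʳ-* a d) (-‿distribˡ-* b c))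

  conj-1 : conj 1ᶜ ≈ᶜ 1ᶜ
  conj-1 = refl , -0#≈0#

  unimodular⇒inverse : ∀ {z} → Unimodular z → z *ᶜ conj z ≈ᶜ 1ᶜ
  unimodular⇒inverse {a +i b} |z|≈1 =
      trans (+-congˡ (trans (-‿cong (sym (-‿distribʳ-* b b))) (-‿involutive (b * b)))) |z|≈1
    , trans (+-cong (sym (-‿distribʳ-* a b)) (*-comm b a)) (-‿inverseˡ (a * b))

  unimodular⇒inverse′ : ∀ {z} → Unimodular z → conj z *ᶜ z ≈ᶜ 1ᶜ
  unimodular⇒inverse′ {z} |z|≈1 = transᶜ (*ᶜ-comm (conj z) z) (unimodular⇒inverse |z|≈1)

  1ᶜ-unimodular : Unimodular 1ᶜ
  1ᶜ-unimodular = trans (+-cong (*-identityˡ 1#) (zeroˡ 0#)) (+-identityʳ 1#)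

  ^ℕ-cong : ∀ {z w} n → z ≈ᶜ w → z ^ℕ n ≈ᶜ w ^ℕ n
  ^ℕ-cong zero    z≈w = reflᶜ
  ^ℕ-cong (suc n) z≈w = *ᶜ-cong z≈w (^ℕ-cong n z≈w)

  ^ᶜ-cong : ∀ {z w} i → z ≈ᶜ w → z ^ᶜ i ≈ᶜ w ^ᶜ i
  ^ᶜ-cong (+ n)    z≈w = ^ℕ-cong n z≈w
  ^ᶜ-cong -[1+ n ] z≈w = ^ℕ-cong (suc n) (conj-cong z≈w)

  conj-^ℕ : ∀ z n → conj (z ^ℕ n) ≈ᶜ conj z ^ℕ n
  conj-^ℕ z zero    = conj-1
  conj-^ℕ z (suc n) = transᶜ (conj-* z (z ^ℕ n)) (*ᶜ-congˡ (conj-^ℕ z n))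

  conj-^ᶜ : ∀ z i → conj (z ^ᶜ i) ≈ᶜ z ^ᶜ (ℤ.- i)
  conj-^ᶜ z (+ zero)  = conj-1
  conj-^ᶜ z (+ suc n) = conj-^ℕ z (suc n)
  conj-^ᶜ z -[1+ n ]  = transᶜ (conj-^ℕ (conj z) (suc n)) (^ℕ-cong (suc n) (conj-involutive z))

  1^ℕ : ∀ n → 1ᶜ ^ℕ n ≈ᶜ 1ᶜ
  1^ℕ zero    = reflᶜ
  1^ℕ (suc n) = transᶜ (*ᶜ-identityˡ _) (1^ℕ n)

  1^ᶜ : ∀ i → 1ᶜ ^ᶜ i ≈ᶜ 1ᶜ
  1^ᶜ (+ n)    = 1^ℕ n
  1^ᶜ -[1+ n ] = transᶜ (^ℕ-cong (suc n) conj-1) (1^ℕ (suc n))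

  module Powers {z : ℂ} (|z|≈1 : Unimodular z) where

    ^ᶜ-suc : ∀ i → z ^ᶜ (1ℤ ℤ.+ i) ≈ᶜ z *ᶜ z ^ᶜ i
    ^ᶜ-suc (+ n)        = reflᶜ
    ^ᶜ-suc -[1+ zero ]  = symᶜ (transᶜ (*ᶜ-congˡ (*ᶜ-identityʳ _)) (unimodular⇒inverse |z|≈1))
    ^ᶜ-suc -[1+ suc n ] = symᶜ (begin
      z *ᶜ (conj z *ᶜ (conj z ^ℕ suc n))  ≈⟨ symᶜ (*ᶜ-assoc _ _ _) ⟩
      (z *ᶜ conj z) *ᶜ (conj z ^ℕ suc n)  ≈⟨ *ᶜ-congʳ (unimodular⇒inverse |z|≈1) ⟩
      1ᶜ *ᶜ (conj z ^ℕ suc n)             ≈⟨ *ᶜ-identityˡ _ ⟩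
      conj z ^ℕ suc n                     ∎)

    ^ᶜ-pred : ∀ i → z ^ᶜ (-1ℤ ℤ.+ i) ≈ᶜ conj z *ᶜ z ^ᶜ i
    ^ᶜ-pred i = symᶜ (begin
      conj z *ᶜ z ^ᶜ i                          ≈⟨ *ᶜ-congˡ (reflexiveᶜ (≡.cong (z ^ᶜ_) i≡)) ⟩
      conj z *ᶜ z ^ᶜ (1ℤ ℤ.+ (-1ℤ ℤ.+ i))       ≈⟨ *ᶜ-congˡ (^ᶜ-suc (-1ℤ ℤ.+ i)) ⟩
      conj z *ᶜ (z *ᶜ z ^ᶜ (-1ℤ ℤ.+ i))         ≈⟨ symᶜ (*ᶜ-assoc _ _ _) ⟩
      (conj z *ᶜ z) *ᶜ z ^ᶜ (-1ℤ ℤ.+ i)         ≈⟨ *ᶜ-congʳ (unimodular⇒inverse′ |z|≈1) ⟩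
      1ᶜ *ᶜ z ^ᶜ (-1ℤ ℤ.+ i)                    ≈⟨ *ᶜ-identityˡ _ ⟩
      z ^ᶜ (-1ℤ ℤ.+ i)                          ∎)
      where
      i≡ : i ≡.≡ 1ℤ ℤ.+ (-1ℤ ℤ.+ i)
      i≡ = ≡.trans (≡.sym (ℤ.+-identityˡ i)) (ℤ.+-assoc 1ℤ -1ℤ i)

    private
      -- Exponents of both signs recurse alike: `k` is 1 or -1, and `w` is accordingly `z` or
      -- `conj z`.
      step : ∀ {w} k i j → (∀ l → z ^ᶜ (k ℤ.+ l) ≈ᶜ w *ᶜ z ^ᶜ l) →
             z ^ᶜ (i ℤ.+ j) ≈ᶜ z ^ᶜ i *ᶜ z ^ᶜ j →
             z ^ᶜ (k ℤ.+ i ℤ.+ j) ≈ᶜ z ^ᶜ (k ℤ.+ i) *ᶜ z ^ᶜ j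
      step {w} k i j shift ih = begin
        z ^ᶜ (k ℤ.+ i ℤ.+ j)         ≈⟨ reflexiveᶜ (≡.cong (z ^ᶜ_) (ℤ.+-assoc k i j)) ⟩
        z ^ᶜ (k ℤ.+ (i ℤ.+ j))       ≈⟨ shift (i ℤ.+ j) ⟩
        w *ᶜ z ^ᶜ (i ℤ.+ j)          ≈⟨ *ᶜ-congˡ ih ⟩
        w *ᶜ (z ^ᶜ i *ᶜ z ^ᶜ j)      ≈⟨ symᶜ (*ᶜ-assoc _ _ _) ⟩
        (w *ᶜ z ^ᶜ i) *ᶜ z ^ᶜ j      ≈⟨ *ᶜ-congʳ (symᶜ (shift i)) ⟩
        z ^ᶜ (k ℤ.+ i) *ᶜ z ^ᶜ j     ∎

    ^ᶜ-+ : ∀ i j → z ^ᶜ (i ℤ.+ j) ≈ᶜ z ^ᶜ i *ᶜ z ^ᶜ j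
    ^ᶜ-+ (+ zero)     j = transᶜ (reflexiveᶜ (≡.cong (z ^ᶜ_) (ℤ.+-identityˡ j))) (symᶜ (*ᶜ-identityˡ _))
    ^ᶜ-+ (+ suc n)    j = step 1ℤ (+ n) j ^ᶜ-suc (^ᶜ-+ (+ n) j)
    ^ᶜ-+ -[1+ zero ]  j = transᶜ (^ᶜ-pred j) (*ᶜ-congʳ (symᶜ (*ᶜ-identityʳ _)))
    ^ᶜ-+ -[1+ suc n ] j = step -1ℤ -[1+ n ] j ^ᶜ-pred (^ᶜ-+ -[1+ n ] j)

    ^ᶜ-*ℕ : ∀ i n → (z ^ᶜ i) ^ℕ n ≈ᶜ z ^ᶜ (+ n ℤ.* i)
    ^ᶜ-*ℕ i zero    = reflexiveᶜ (≡.cong (z ^ᶜ_) (≡.sym (ℤ.*-zeroˡ i)))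
    ^ᶜ-*ℕ i (suc n) = begin
      z ^ᶜ i *ᶜ (z ^ᶜ i) ^ℕ n          ≈⟨ *ᶜ-congˡ (^ᶜ-*ℕ i n) ⟩
      z ^ᶜ i *ᶜ z ^ᶜ (+ n ℤ.* i)       ≈⟨ symᶜ (^ᶜ-+ i (+ n ℤ.* i)) ⟩
      z ^ᶜ (i ℤ.+ + n ℤ.* i)           ≈⟨ reflexiveᶜ (≡.cong (z ^ᶜ_) (≡.sym (ℤ.suc-* (+ n) i))) ⟩
      z ^ᶜ (+ suc n ℤ.* i)             ∎

    ^ᶜ-* : ∀ i j → (z ^ᶜ i) ^ᶜ j ≈ᶜ z ^ᶜ (j ℤ.* i)
    ^ᶜ-* i (+ n)    = ^ᶜ-*ℕ i n
    ^ᶜ-* i -[1+ n ] = begin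
      conj (z ^ᶜ i) ^ℕ suc n           ≈⟨ ^ℕ-cong (suc n) (conj-^ᶜ z i) ⟩
      (z ^ᶜ (ℤ.- i)) ^ℕ suc n          ≈⟨ ^ᶜ-*ℕ (ℤ.- i) (suc n) ⟩
      z ^ᶜ (+ suc n ℤ.* ℤ.- i)         ≈⟨ reflexiveᶜ (≡.cong (z ^ᶜ_) (neg-swap (+ suc n) i)) ⟩
      z ^ᶜ (-[1+ n ] ℤ.* i)            ∎
      where
      neg-swap : ∀ i j → i ℤ.* ℤ.- j ≡.≡ ℤ.- i ℤ.* j
      neg-swap i j = ≡.trans (≡.sym (ℤ.neg-distribʳ-* i j)) (ℤ.neg-distribˡ-* i j)

  exp-i-cong : ∀ {x y} → x ≈ y → exp-i x ≈ᶜ exp-i y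
  exp-i-cong x≈y = cos-cong x≈y , sin-cong x≈y

  exp-i-unimodular : ∀ x → Unimodular (exp-i x)
  exp-i-unimodular = cos²+sin²

  exp-i-0 : exp-i 0# ≈ᶜ 1ᶜ
  exp-i-0 = cos-0 , sin-0

  exp-i-+ : ∀ x y → exp-i (x + y) ≈ᶜ exp-i x *ᶜ exp-i y
  exp-i-+ x y = cos-+ x y , sin-+ x y

  exp-i-^ℕ : ∀ x n → exp-i x ^ℕ n ≈ᶜ exp-i (n · x)
  exp-i-^ℕ x zero    = symᶜ exp-i-0
  exp-i-^ℕ x (suc n) = transᶜ (*ᶜ-congˡ (exp-i-^ℕ x n)) (symᶜ (exp-i-+ x (n · x)))

-- ζ as a primitive 2N-th root of unity

module RootsOfUnity {c ℓ₁ ℓ₂ ℓ₃} {ℝ : RealNumbers c ℓ₁ ℓ₂ ℓ₃}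
                    (T : Trigonometry ℝ) (N : ℕ) .{{_ : NonZero N}} where
  open RealNumbers ℝ
  open RealProperties ℝ
  open Trigonometry T
  open TrigonometryProperties T
  open Complex T
  open ComplexProperties T
  open Sequences T N using (ζ; W)
  open import Relation.Binary.Reasoning.Setoid ℂ-setoid

  ζ-unimodular : Unimodular ζ
  ζ-unimodular = exp-i-unimodular (- (π /ℕ N))

  open Powers ζ-unimodular public
    using () renaming (^ᶜ-+ to ζ-+; ^ᶜ-* to ζ-*)

  -1ᶜ : ℂ
  -1ᶜ = (- 1#) +i 0#

  -1ᶜ*-1ᶜ : -1ᶜ *ᶜ -1ᶜ ≈ᶜ 1ᶜ
  -1ᶜ*-1ᶜ =
      trans (+-cong (trans (-1*x≈-x (- 1#)) (-‿involutive 1#)) (-‿cong (zeroˡ 0#))) (x-0≈x 1#)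
    , trans (+-cong (zeroʳ _) (zeroˡ _)) (+-identityˡ 0#)

  ζ-angle : ∀ n → ζ ^ℕ n ≈ᶜ exp-i (- (n · (π /ℕ N)))
  ζ-angle n = transᶜ (exp-i-^ℕ (- (π /ℕ N)) n) (exp-i-cong (·-neg n (π /ℕ N)))

  ζ^N : ζ ^ℕ N ≈ᶜ -1ᶜ
  ζ^N = begin
    ζ ^ℕ N                        ≈⟨ ζ-angle N ⟩
    exp-i (- (N · (π /ℕ N)))      ≈⟨ exp-i-cong (-‿cong (/ℕ-inverse N π)) ⟩
    exp-i (- π)                   ≈⟨ trans (cos-neg π) cos-π , trans (sin-neg π) (trans (-‿cong sin-π) -0#≈0#) ⟩
    -1ᶜ                           ∎

  ζ^[N+N] : ζ ^ℕ (N ℕ.+ N) ≈ᶜ 1ᶜ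
  ζ^[N+N] = transᶜ (ζ-+ (+ N) (+ N)) (transᶜ (*ᶜ-cong ζ^N ζ^N) -1ᶜ*-1ᶜ)

  -- Halving the angle brings it into the range where the sine is known to be positive: with δ =
  -- π/2N, the bounds 0 < r < N say exactly that 0 < rδ < π/2, and the real part of ζ^r is cos 2rδ.
  ζ^r≉1 : ∀ r → 0 ℕ.< r → r ℕ.< N → ¬ (ζ ^ℕ r ≈ᶜ 1ᶜ)
  ζ^r≉1 (suc r) _ r<N ζ^r≈1 = cos[x+x]≉1 (·-pos r 0<δ) rδ<π/2 (trans (sym cos≈) (proj₁ ζ^r≈1))
    where
    θ δ : Carrier
    θ = π /ℕ N
    δ = θ /ℕ 2
    0<δ : 0# < δ
    0<δ = /ℕ-pos 2 (/ℕ-pos N 0<π)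
    double : ∀ n → n · δ + n · δ ≈ n · θ
    double n = trans (sym (·-distrib-+ δ δ n)) (·-congʳ n (halves θ))
    Nδ≈π/2 : N · δ ≈ π /ℕ 2
    Nδ≈π/2 = half-unique (trans (double N) (trans (/ℕ-inverse N π) (sym (halves π))))
    rδ<π/2 : suc r · δ < π /ℕ 2
    rδ<π/2 = <.<-respʳ-≈ Nδ≈π/2 (·-monoˡ-< 0<δ r<N)
    cos≈ : re (ζ ^ℕ suc r) ≈ cos (suc r · δ + suc r · δ)
    cos≈ = trans (proj₁ (ζ-angle (suc r))) (trans (cos-neg _) (cos-cong (sym (double (suc r)))))

  ζ-periodic : ∀ q → ζ ^ᶜ (q ℤ.* + (N ℕ.+ N)) ≈ᶜ 1ᶜ
  ζ-periodic q = begin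
    ζ ^ᶜ (q ℤ.* + (N ℕ.+ N))    ≈⟨ symᶜ (ζ-* (+ (N ℕ.+ N)) q) ⟩
    (ζ ^ℕ (N ℕ.+ N)) ^ᶜ q       ≈⟨ ^ᶜ-cong q ζ^[N+N] ⟩
    1ᶜ ^ᶜ q                     ≈⟨ 1^ᶜ q ⟩
    1ᶜ                          ∎

  -- The angle argument reaches only exponents below N. At N the value is -1, and above N the
  -- complementary exponent 2N - r lies below N and would give 1 as well.
  ζ^r≈1⇒r≡0 : ∀ r → r ℕ.< N ℕ.+ N → ζ ^ℕ r ≈ᶜ 1ᶜ → r ≡.≡ 0
  ζ^r≈1⇒r≡0 zero    _     _     = ≡.refl
  ζ^r≈1⇒r≡0 (suc r) r<2N ζ^r≈1 with ℕ.<-cmp (suc r) N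
  ... | tri< r<N _ _ = contradiction ζ^r≈1 (ζ^r≉1 (suc r) ℕ.z<s r<N)
  ... | tri≈ _ ≡.refl _ = contradiction (trans (sym (proj₁ ζ^r≈1)) (proj₁ ζ^N)) 1≉-1
  ... | tri> _ _ N<r = contradiction ζ^s≈1 (ζ^r≉1 s (ℕ.m<n⇒0<n∸m r<2N) s<N)
    where
    s = N ℕ.+ N ℕ.∸ suc r
    s+r≡2N : s ℕ.+ suc r ≡.≡ N ℕ.+ N
    s+r≡2N = ℕ.m∸n+n≡m (ℕ.<⇒≤ r<2N)
    s<N : s ℕ.< N
    s<N = ℕ.+-cancelʳ-< (suc r) s N
      (≡.subst (ℕ._< N ℕ.+ suc r) (≡.sym s+r≡2N) (ℕ.+-monoʳ-< N N<r))
    ζ^s≈1 : ζ ^ℕ s ≈ᶜ 1ᶜ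
    ζ^s≈1 = begin
      ζ ^ℕ s                    ≈⟨ symᶜ (*ᶜ-identityʳ _) ⟩
      ζ ^ℕ s *ᶜ 1ᶜ              ≈⟨ *ᶜ-congˡ (symᶜ ζ^r≈1) ⟩
      ζ ^ℕ s *ᶜ ζ ^ℕ suc r      ≈⟨ symᶜ (ζ-+ (+ s) (+ suc r)) ⟩
      ζ ^ℕ (s ℕ.+ suc r)        ≈⟨ reflexiveᶜ (≡.cong (ζ ^ℕ_) s+r≡2N) ⟩
      ζ ^ℕ (N ℕ.+ N)            ≈⟨ ζ^[N+N] ⟩
      1ᶜ                        ∎

  ζ-cong : ∀ i j → + (N ℕ.+ N) ∣ i ℤ.- j → ζ ^ᶜ i ≈ᶜ ζ ^ᶜ j
  ζ-cong i j (divides q i-j≡q2N) = begin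
    ζ ^ᶜ i                                ≈⟨ reflexiveᶜ (≡.cong (ζ ^ᶜ_) i≡) ⟩
    ζ ^ᶜ (q ℤ.* + (N ℕ.+ N) ℤ.+ j)        ≈⟨ ζ-+ (q ℤ.* + (N ℕ.+ N)) j ⟩
    ζ ^ᶜ (q ℤ.* + (N ℕ.+ N)) *ᶜ ζ ^ᶜ j    ≈⟨ *ᶜ-congʳ (ζ-periodic q) ⟩
    1ᶜ *ᶜ ζ ^ᶜ j                          ≈⟨ *ᶜ-identityˡ _ ⟩
    ζ ^ᶜ j                                ∎
    where
    split : ∀ i j → i ≡.≡ (i ℤ.- j) ℤ.+ j
    split = solve-∀
    i≡ : i ≡.≡ q ℤ.* + (N ℕ.+ N) ℤ.+ j
    i≡ = ≡.trans (split i j) (≡.cong (ℤ._+ j) i-j≡q2N)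

  -- Division by 2N leaves a remainder r < 2N for which still ζ^r ≈ 1, and such a remainder is 0.
  ζ^i≈1⇒2N∣i : ∀ i → ζ ^ᶜ i ≈ᶜ 1ᶜ → + (N ℕ.+ N) ∣ i
  ζ^i≈1⇒2N∣i i ζ^i≈1 = divides q
    (≡.trans i≡ (≡.trans (≡.cong (λ r → + r ℤ.+ q ℤ.* + (N ℕ.+ N)) r≡0) (ℤ.+-identityˡ _)))
    where
    instance
      2N≢0 : NonZero (N ℕ.+ N)
      2N≢0 = ℕ.≢-nonZero (λ 2N≡0 → ℕ.≢-nonZero⁻¹ N (ℕ.m+n≡0⇒m≡0 N 2N≡0))
    r = i %ℕ (N ℕ.+ N)
    q = i /ℕ′ (N ℕ.+ N)
    i≡ : i ≡.≡ + r ℤ.+ q ℤ.* + (N ℕ.+ N)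
    i≡ = a≡a%ℕn+[a/ℕn]*n i (N ℕ.+ N)
    r≡0 : r ≡.≡ 0
    r≡0 = ζ^r≈1⇒r≡0 r (n%ℕd<d i (N ℕ.+ N)) (begin
      ζ ^ᶜ (+ r)                                  ≈⟨ symᶜ (*ᶜ-identityʳ _) ⟩
      ζ ^ᶜ (+ r) *ᶜ 1ᶜ                            ≈⟨ *ᶜ-congˡ (symᶜ (ζ-periodic q)) ⟩
      ζ ^ᶜ (+ r) *ᶜ ζ ^ᶜ (q ℤ.* + (N ℕ.+ N))      ≈⟨ symᶜ (ζ-+ (+ r) (q ℤ.* + (N ℕ.+ N))) ⟩
      ζ ^ᶜ (+ r ℤ.+ q ℤ.* + (N ℕ.+ N))            ≈⟨ reflexiveᶜ (≡.cong (ζ ^ᶜ_) (≡.sym i≡)) ⟩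
      ζ ^ᶜ i                                      ≈⟨ ζ^i≈1 ⟩
      1ᶜ                                          ∎)

  ζ-injective : ∀ i j → ζ ^ᶜ i ≈ᶜ ζ ^ᶜ j → + (N ℕ.+ N) ∣ i ℤ.- j
  ζ-injective i j ζ^i≈ζ^j = ζ^i≈1⇒2N∣i (i ℤ.- j) (begin
    ζ ^ᶜ (i ℤ.- j)              ≈⟨ ζ-+ i (ℤ.- j) ⟩
    ζ ^ᶜ i *ᶜ ζ ^ᶜ (ℤ.- j)      ≈⟨ *ᶜ-congʳ ζ^i≈ζ^j ⟩
    ζ ^ᶜ j *ᶜ ζ ^ᶜ (ℤ.- j)      ≈⟨ symᶜ (ζ-+ j (ℤ.- j)) ⟩
    ζ ^ᶜ (j ℤ.- j)              ≈⟨ reflexiveᶜ (≡.cong (ζ ^ᶜ_) (ℤ.+-inverseʳ j)) ⟩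
    1ᶜ                          ∎)

  W-ζ : ∀ i → W ^ᶜ i ≈ᶜ ζ ^ᶜ (i ℤ.* + 2)
  W-ζ i = ζ-* (+ 2) i

  W-cong : ∀ i j → + N ∣ i ℤ.- j → W ^ᶜ i ≈ᶜ W ^ᶜ j
  W-cong i j (divides q i-j≡qN) = transᶜ (W-ζ i) (transᶜ (ζ-cong (i ℤ.* + 2) (j ℤ.* + 2) (divides q eq)) (symᶜ (W-ζ j)))
    where
    lemma₁ : ∀ i j → i ℤ.* + 2 ℤ.- j ℤ.* + 2 ≡.≡ (i ℤ.- j) ℤ.* + 2
    lemma₁ = solve-∀
    lemma₂ : ∀ q n → q ℤ.* n ℤ.* + 2 ≡.≡ q ℤ.* (n ℤ.+ n)
    lemma₂ = solve-∀
    eq : i ℤ.* + 2 ℤ.- j ℤ.* + 2 ≡.≡ q ℤ.* + (N ℕ.+ N)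
    eq = ≡.trans (lemma₁ i j) (≡.trans (≡.cong (ℤ._* + 2) i-j≡qN) (lemma₂ q (+ N)))

  W-+ : ∀ i j → W ^ᶜ (i ℤ.+ j) ≈ᶜ W ^ᶜ i *ᶜ W ^ᶜ j
  W-+ i j = begin
    W ^ᶜ (i ℤ.+ j)                            ≈⟨ W-ζ (i ℤ.+ j) ⟩
    ζ ^ᶜ ((i ℤ.+ j) ℤ.* + 2)                  ≈⟨ reflexiveᶜ (≡.cong (ζ ^ᶜ_) (ℤ.*-distribʳ-+ (+ 2) i j)) ⟩
    ζ ^ᶜ (i ℤ.* + 2 ℤ.+ j ℤ.* + 2)            ≈⟨ ζ-+ (i ℤ.* + 2) (j ℤ.* + 2) ⟩
    ζ ^ᶜ (i ℤ.* + 2) *ᶜ ζ ^ᶜ (j ℤ.* + 2)      ≈⟨ *ᶜ-cong {ζ ^ᶜ (i ℤ.* + 2)} {W ^ᶜ i} {ζ ^ᶜ (j ℤ.* + 2)} {W ^ᶜ j} (symᶜ (W-ζ i)) (symᶜ (W-ζ j)) ⟩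
    W ^ᶜ i *ᶜ W ^ᶜ j                          ∎

module _ where
  open import Level using (_⊔_)
  open import Data.Fin.Base using (toℕ)
  open import Data.Fin.Properties using (toℕ-fromℕ<; toℕ-injective; toℕ<n)
  open import Data.Integer.Base using (_+_; _*_; _-_; -_)
  import Data.Integer.Coprimality as ℤ
  open import Data.Integer.GCD using (gcd; gcd-zeroˡ)
  open import Data.List.Base using ([]; _∷_)
  open import Data.List.Relation.Unary.All using (_∷_)
  open import Data.Nat.Base using (_^_)
  open import Data.Nat.Coprimality as ℕ using (Coprime)
  import Data.Nat.Divisibility as ℕ
  import Data.Nat.DivMod as ℕ
  import Data.Nat.GCD as ℕ
  open import Data.Nat.ListAction using (product)
  open import Data.Nat.Primality.Factorisation using (factorise)
  open import Function.Base using (_∘_)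
  open import Function.Definitions using (Bijective)
  open import Relation.Binary.Construct.Closure.ReflexiveTransitive using (ε; _◅_)
  open ≡ using (_≡_; _≢_; refl; sym; trans; cong; subst)
  open import Relation.Nullary.Decidable using (yes; no; from-yes; from-no)

  -- Congruences and residue classes

  module Congruence (n : ℤ) where
    infix 4 _≋_

    -- A record rather than a synonym for `n ∣ i - j`, so that unification can recover `i` and `j`
    -- from the type.
    record _≋_ (i j : ℤ) : Set where
      constructor congruent
      field difference : n ∣ i - j
    open _≋_ public

    ≋-refl : ∀ {i} → i ≋ i
    ≋-refl {i} = congruent (divides 0ℤ (ℤ.+-inverseʳ i))

    ≋-reflexive : ∀ {i j} → i ≡ j → i ≋ j
    ≋-reflexive refl = ≋-refl

    ≋-sym : ∀ {i j} → i ≋ j → j ≋ i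
    ≋-sym {i} {j} (congruent d) = congruent (subst (n ∣_) (lemma i j) (∣m⇒∣-m d))
      where
      lemma : ∀ i j → - (i - j) ≡ j - i
      lemma = solve-∀

    ≋-trans : ∀ {i j k} → i ≋ j → j ≋ k → i ≋ k
    ≋-trans {i} {j} {k} (congruent d) (congruent e) =
      congruent (subst (n ∣_) (lemma i j k) (∣m∣n⇒∣m+n d e))
      where
      lemma : ∀ i j k → (i - j) + (j - k) ≡ i - k
      lemma = solve-∀

    +-cong : ∀ {i j k l} → i ≋ j → k ≋ l → i + k ≋ j + l
    +-cong {i} {j} {k} {l} (congruent d) (congruent e) =
      congruent (subst (n ∣_) (lemma i j k l) (∣m∣n⇒∣m+n d e))
      where
      lemma : ∀ i j k l → (i - j) + (k - l) ≡ (i + k) - (j + l)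
      lemma = solve-∀

    *-cong : ∀ {i j k l} → i ≋ j → k ≋ l → i * k ≋ j * l
    *-cong {i} {j} {k} {l} (congruent d) (congruent e) =
      congruent (subst (n ∣_) (lemma i j k l) (∣m∣n⇒∣m+n (∣n⇒∣m*n k d) (∣n⇒∣m*n j e)))
      where
      lemma : ∀ i j k l → k * (i - j) + j * (k - l) ≡ i * k - j * l
      lemma = solve-∀

    neg-cong : ∀ {i j} → i ≋ j → - i ≋ - j
    neg-cong {i} {j} (congruent d) = congruent (subst (n ∣_) (lemma i j) (∣m⇒∣-m d))
      where
      lemma : ∀ i j → - (i - j) ≡ - i - - j
      lemma = solve-∀

    *-congˡ : ∀ i {j k} → j ≋ k → i * j ≋ i * k
    *-congˡ i = *-cong (≋-refl {i})

    ∣⇒≋0 : ∀ {i} → n ∣ i → i ≋ 0ℤ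
    ∣⇒≋0 {i} n∣i = congruent (subst (n ∣_) (sym (ℤ.+-identityʳ i)) n∣i)

    ≋0⇒∣ : ∀ {i} → i ≋ 0ℤ → n ∣ i
    ≋0⇒∣ {i} (congruent d) = subst (n ∣_) (ℤ.+-identityʳ i) d

    ≋-multiple : ∀ {i j} q → i - j ≡ q * n → i ≋ j
    ≋-multiple q eq = congruent (divides q eq)

  -- Polynomial identities are handled over ℤ, where the ring solver applies; reduction modulo N
  -- enters afterwards through congruences.
  quad : ℤ → ℤ → ℤ → ℤ
  quad a b x = a * (x * x) + b * x

  module ResidueProperties (N : ℕ) .{{_ : NonZero N}} where
    open Residues N
    open Congruence (+ N)

    quad-cong : ∀ {a a′ b b′ x x′} → a ≋ a′ → b ≋ b′ → x ≋ x′ → quad a b x ≋ quad a′ b′ x′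
    quad-cong a b x = +-cong (*-cong a (*-cong x x)) (*-cong b x)

    quad-congˣ : ∀ a b {x x′} → x ≋ x′ → quad a b x ≋ quad a b x′
    quad-congˣ a b = quad-cong (≋-refl {a}) (≋-refl {b})

    repr-residue : ∀ m → repr (residue m) ≋ m
    repr-residue m = ≋-sym (≋-multiple (m /ℕ′ N) (begin
      m - repr (residue m)                            ≡⟨ cong (λ r → m - + r) (toℕ-fromℕ< (n%ℕd<d m N)) ⟩
      m - + (m %ℕ N)                                  ≡⟨ cong (_- + (m %ℕ N)) (a≡a%ℕn+[a/ℕn]*n m N) ⟩
      + (m %ℕ N) + (m /ℕ′ N) * + N - + (m %ℕ N)       ≡⟨ lemma (+ (m %ℕ N)) ((m /ℕ′ N) * + N) ⟩
      (m /ℕ′ N) * + N                                 ∎))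
      where
      open ≡.≡-Reasoning
      lemma : ∀ i j → i + j - i ≡ j
      lemma = solve-∀

    -- Two least residues differ by less than N in absolute value, so a difference divisible by N is
    -- 0.
    repr-injective : ∀ {j k} → repr j ≋ repr k → j ≡ k
    repr-injective {j} {k} (congruent N∣) =
      toℕ-injective (ℤ.+-injective (ℤ.i-j≡0⇒i≡j (repr j) (repr k) (ℤ.∣i∣≡0⇒i≡0 (small (∣⇒∣ᵤ N∣) bound))))
      where
      bound : ℤ.∣ repr j - repr k ∣ ℕ.< N
      bound = ℕ.≤-<-trans
        (subst (λ i → ℤ.∣ i ∣ ℕ.≤ toℕ j ℕ.⊔ toℕ k) (sym (ℤ.m-n≡m⊖n (toℕ j) (toℕ k))) (ℤ.∣m⊝n∣≤m⊔n (toℕ j) (toℕ k)))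
        (ℕ.⊔-pres-<m (toℕ<n j) (toℕ<n k))
      small : ∀ {m} → N ℕ.∣ m → m ℕ.< N → m ≡ 0
      small {zero}  _   _   = refl
      small {suc m} N∣m m<N = contradiction N∣m (ℕ.>⇒∤ m<N)

    residue-cong : ∀ {i j} → i ≋ j → residue i ≡ residue j
    residue-cong {i} {j} i≋j =
      repr-injective (≋-trans (repr-residue i) (≋-trans i≋j (≋-sym (repr-residue j))))

    residue-injective : ∀ {i j} → residue i ≡ residue j → i ≋ j
    residue-injective {i} {j} eq =
      ≋-trans (≋-sym (repr-residue i)) (≋-trans (≋-reflexive (cong repr eq)) (repr-residue j))

    repr-⊕ : ∀ j k → repr (j ⊕ k) ≋ repr j + repr k
    repr-⊕ j k = repr-residue _

    repr-⊗ : ∀ j k → repr (j ⊗ k) ≋ repr j * repr k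
    repr-⊗ j k = repr-residue _

    repr-quadratic : ∀ a b x → repr (quadratic a b x) ≋ quad (repr a) (repr b) (repr x)
    repr-quadratic a b x = ≋-trans (repr-⊕ (a ⊗ (x ⊗ x)) (b ⊗ x))
      (+-cong (≋-trans (repr-⊗ a (x ⊗ x)) (*-congˡ (repr a) (repr-⊗ x x))) (repr-⊗ b x))

    repr-quadratic-residue : ∀ a b x →
      repr (quadratic (residue a) (residue b) x) ≋ quad a b (repr x)
    repr-quadratic-residue a b x = ≋-trans (repr-quadratic (residue a) (residue b) x)
      (quad-cong (repr-residue a) (repr-residue b) ≋-refl)

    quadratic-residue : ∀ a b x → quadratic a b (residue x) ≡ residue (quad (repr a) (repr b) x)
    quadratic-residue a b x = repr-injective (≋-trans (repr-quadratic a b (residue x))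
      (≋-trans (quad-congˣ (repr a) (repr b) (repr-residue x)) (≋-sym (repr-residue _))))

    -- Collisions are later sought at unrestricted integers such as y and y + N/p, hence the passage
    -- from `Fin` to congruence on ℤ.
    quadratic-injective⇒quad-injective : ∀ {a b} → Bijective _≡_ _≡_ (quadratic a b) →
      ∀ x y → quad (repr a) (repr b) x ≋ quad (repr a) (repr b) y → x ≋ y
    quadratic-injective⇒quad-injective {a} {b} (injective , _) x y eq =
      residue-injective (injective (trans (quadratic-residue a b x)
        (trans (residue-cong eq) (sym (quadratic-residue a b y)))))

    residue≢0 : ∀ {a} → ¬ (+ N ∣ a) → residue a ≢ residue 0ℤ
    residue≢0 N∤a eq = N∤a (≋0⇒∣ (residue-injective eq))

    -- If a² = 0, then y ↦ y − a y² inverts x ↦ x + a x².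
    nilpotent⇒𝒬 : ∀ {a} → + N ∣ a * a → ¬ (+ N ∣ a) → 𝒬 (residue a) (residue 1ℤ)
    nilpotent⇒𝒬 {a} (divides q a²≡qN) N∤a =
      ((λ {x} {y} → injective x y) , surjective) , residue≢0 N∤a
      where
      f g : ℤ → ℤ
      f = quad a 1ℤ
      g = quad (- a) 1ℤ
      f∘g : ∀ x → f (g x) ≋ x
      f∘g x = ≋-multiple (x * x * x * (a * x - + 2) * q) (trans (lemma a x)
        (trans (cong (x * x * x * (a * x - + 2) *_) a²≡qN) (sym (ℤ.*-assoc (x * x * x * (a * x - + 2)) q (+ N)))))
        where
        lemma : ∀ a x → let y = - a * (x * x) + 1ℤ * x in
                a * (y * y) + 1ℤ * y - x ≡ x * x * x * (a * x - + 2) * (a * a)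
        lemma = solve-∀
      g∘f : ∀ x → g (f x) ≋ x
      g∘f x = ≋-multiple (x * x * x * (- a * x - + 2) * q) (trans (lemma a x)
        (trans (cong (x * x * x * (- a * x - + 2) *_) a²≡qN) (sym (ℤ.*-assoc (x * x * x * (- a * x - + 2)) q (+ N)))))
        where
        lemma : ∀ a x → let y = a * (x * x) + 1ℤ * x in
                - a * (y * y) + 1ℤ * y - x ≡ x * x * x * (- a * x - + 2) * (a * a)
        lemma = solve-∀
      F : ℤ/N → ℤ/N
      F = quadratic (residue a) (residue 1ℤ)
      G : ℤ/N → ℤ/N
      G y = residue (g (repr y))
      G∘F : ∀ x → G (F x) ≡ x
      G∘F x = repr-injective (≋-trans (repr-residue _) (≋-trans
        (quad-congˣ (- a) 1ℤ (repr-quadratic-residue a 1ℤ x)) (g∘f (repr x))))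
      F∘G : ∀ y → F (G y) ≡ y
      F∘G y = repr-injective (≋-trans (repr-quadratic-residue a 1ℤ (G y)) (≋-trans
        (quad-congˣ a 1ℤ (repr-residue (g (repr y)))) (f∘g (repr y))))
      injective : ∀ x y → F x ≡ F y → x ≡ y
      injective x y eq = trans (sym (G∘F x)) (trans (cong G eq) (G∘F y))
      surjective : ∀ y → ∃ λ x → ∀ {z} → z ≡ x → F z ≡ y
      surjective y = G y , λ { refl → F∘G y }

  -- Primes and coprimality

  ∃-primeDivisor : ∀ n .{{_ : NonZero n}} → n ≢ 1 → ∃[ p ] Prime p × p ℕ.∣ n
  ∃-primeDivisor n n≢1 with factorise n
  ... | record { factors = [] ; isFactorisation = n≡1 } = contradiction n≡1 n≢1
  ... | record { factors = p ∷ ps ; isFactorisation = n≡ ; factorsPrime = p-prime ∷ _ } =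
    p , p-prime , subst (p ℕ.∣_) (sym n≡) (ℕ.m∣m*n (product ps))

  prime∣prime⇒≡ : ∀ {p q} → Prime p → Prime q → p ℕ.∣ q → p ≡ q
  prime∣prime⇒≡ p-prime q-prime p∣q with prime⇒irreducible q-prime p∣q
  ... | inj₁ refl = contradiction p-prime ¬prime[1]
  ... | inj₂ p≡q  = p≡q

  prime∧∤⇒coprime : ∀ {p n} → Prime p → ¬ (p ℕ.∣ n) → Coprime n p
  prime∧∤⇒coprime p-prime p∤n (d∣n , d∣p) with prime⇒irreducible p-prime d∣p
  ... | inj₁ d≡1  = d≡1
  ... | inj₂ refl = contradiction d∣n p∤n

  prime[3] : Prime 3
  prime[3] = from-yes (prime? 3)

  coprime⇒inverse : ∀ {n p} → Coprime n p → ∃[ v ] + p ∣ v * + n - 1ℤ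
  coprime⇒inverse {n} {p} c with ℕ.coprime-Bézout c
  ... | ℕ.Bézout.+- x y eq = + x , divides (+ y) (begin
      + x * + n - 1ℤ              ≡⟨ cong (_- 1ℤ) (sym (ℤ.pos-* x n)) ⟩
      + (x ℕ.* n) - 1ℤ            ≡⟨ cong (λ k → + k - 1ℤ) (sym eq) ⟩
      + (1 ℕ.+ y ℕ.* p) - 1ℤ      ≡⟨ cong (_- 1ℤ) (ℤ.pos-+ 1 (y ℕ.* p)) ⟩
      1ℤ + + (y ℕ.* p) - 1ℤ       ≡⟨ lemma (+ (y ℕ.* p)) ⟩
      + (y ℕ.* p)                 ≡⟨ ℤ.pos-* y p ⟩
      + y * + p                   ∎)
    where
    open ≡.≡-Reasoning
    lemma : ∀ i → 1ℤ + i - 1ℤ ≡ i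
    lemma = solve-∀
  ... | ℕ.Bézout.-+ x y eq = - + x , divides (- + y) (begin
      - + x * + n - 1ℤ            ≡⟨ lemma (+ x) (+ n) ⟩
      - (1ℤ + + x * + n)          ≡⟨ cong (λ k → - (1ℤ + k)) (sym (ℤ.pos-* x n)) ⟩
      - + (1 ℕ.+ x ℕ.* n)         ≡⟨ cong (λ k → - + k) eq ⟩
      - + (y ℕ.* p)               ≡⟨ cong -_ (ℤ.pos-* y p) ⟩
      - (+ y * + p)               ≡⟨ ℤ.neg-distribˡ-* (+ y) (+ p) ⟩
      - + y * + p                 ∎)
    where
    open ≡.≡-Reasoning
    lemma : ∀ i j → - i * j - 1ℤ ≡ - (1ℤ + i * j)
    lemma = solve-∀

  coprime-cancel : ∀ {N} i j → Coprime N ℤ.∣ i ∣ → + N ∣ i * j → + N ∣ j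
  coprime-cancel {N} i j c N∣ij = ∣ᵤ⇒∣ (ℤ.coprime-divisor (+ N) i j c (∣⇒∣ᵤ N∣ij))

  proper⇒∤ : ∀ {N m} .{{_ : NonZero N}} d → 1 ℕ.< d → N ≡ m ℕ.* d → ¬ (N ℕ.∣ m)
  proper⇒∤ {N} {m} d 1<d N≡md = ℕ.>⇒∤ m<N
    where
    instance
      m≢0 : NonZero m
      m≢0 = ℕ.≢-nonZero λ { refl → ℕ.≢-nonZero⁻¹ N N≡md }
    m<N : m ℕ.< N
    m<N = subst (m ℕ.<_) (sym N≡md) (ℕ.m<m*n m d 1<d)

  -- Quadratics that are injective modulo an odd N

  module InjectiveQuadratic (N : ℕ) .{{_ : NonZero N}} (a : ℕ) (b : ℤ)
    (injective : ∀ x y → Congruence._≋_ (+ N) (quad (+ a) b x) (quad (+ a) b y) →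
                 Congruence._≋_ (+ N) x y)
    (2∤N : ¬ (2 ℕ.∣ N)) (9∤N : ¬ (9 ℕ.∣ N))
    where
    open Congruence (+ N)

    -- π(y + m) − π(y) = m (a (2y + m) + b)
    no-collision : ∀ {p} → Prime p → p ℕ.∣ N →
                   ∃[ m ] ∀ y → ¬ (+ p ∣ + a * (+ 2 * y + m) + b)
    -- The shift is m = N/p: if p divides the second factor, the product is a multiple of N although
    -- the shift itself is not, against injectivity.
    no-collision {p} p-prime (ℕ.divides m N≡mp) = + m , λ y (divides t eq) →
      N∤m (∣⇒∣ᵤ (subst (+ N ∣_) (lemma₁ y (+ m)) (difference (injective (y + + m) y (≋-multiple t (begin
        quad (+ a) b (y + + m) - quad (+ a) b y       ≡⟨ lemma₂ (+ a) b y (+ m) ⟩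
        + m * (+ a * (+ 2 * y + + m) + b)             ≡⟨ cong (+ m *_) eq ⟩
        + m * (t * + p)                               ≡⟨ lemma₃ (+ m) t (+ p) ⟩
        t * (+ m * + p)                               ≡⟨ cong (t *_) (sym (ℤ.pos-* m p)) ⟩
        t * + (m ℕ.* p)                               ≡⟨ cong (λ n → t * + n) (sym N≡mp) ⟩
        t * + N                                       ∎))))))
      where
      open ≡.≡-Reasoning
      lemma₁ : ∀ y m → (y + m) - y ≡ m
      lemma₁ = solve-∀
      lemma₂ : ∀ a b y m → a * ((y + m) * (y + m)) + b * (y + m) - (a * (y * y) + b * y) ≡
                           m * (a * (+ 2 * y + m) + b)
      lemma₂ = solve-∀
      lemma₃ : ∀ m t p → m * (t * p) ≡ t * (m * p)
      lemma₃ = solve-∀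
      N∤m : ¬ (N ℕ.∣ m)
      N∤m = proper⇒∤ p (ℕ.nonTrivial⇒n>1 p {{prime⇒nonTrivial p-prime}}) N≡mp

    p≢2 : ∀ {p} → p ℕ.∣ N → p ≢ 2
    p≢2 p∣N refl = 2∤N p∣N

    prime∤2a : ∀ {p} → Prime p → p ℕ.∣ N → ¬ (p ℕ.∣ a) → ¬ (p ℕ.∣ 2 ℕ.* a)
    prime∤2a p-prime p∣N p∤a p∣2a =
      [ (λ p∣2 → p≢2 p∣N (prime∣prime⇒≡ p-prime prime[2] p∣2)) , p∤a ]′
        (euclidsLemma 2 a p-prime p∣2a)

    -- If p ∤ a, then 2a is invertible mod p, and y can be chosen with a (2y + m) + b ≡ 0.
    prime∣N⇒∣a : ∀ {p} → Prime p → p ℕ.∣ N → p ℕ.∣ a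
    prime∣N⇒∣a {p} p-prime p∣N with p ℕ.∣? a
    ... | yes p∣a = p∣a
    ... | no  p∤a =
      let m , collision = no-collision p-prime p∣N
          v , p∣v2a-1   = coprime⇒inverse (prime∧∤⇒coprime p-prime (prime∤2a p-prime p∣N p∤a))
          w             = - b - + a * m
      in contradiction
        (subst (+ p ∣_)
          (trans (cong (λ k → (v * k - 1ℤ) * w) (ℤ.pos-* 2 a)) (lemma (+ a) b v m))
          (∣m⇒∣m*n {+ p} {v * + (2 ℕ.* a) - 1ℤ} w p∣v2a-1))
        (collision (v * w))
      where
      lemma : ∀ a b v m → (v * (+ 2 * a) - 1ℤ) * (- b - a * m) ≡
                          a * (+ 2 * (v * (- b - a * m)) + m) + b
      lemma = solve-∀

    -- Since p ∣ a is already known, p ∣ b would make the collision factor a (2y + m) + b divisible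
    -- by p, for instance at y = 0.
    prime∣N⇒∤b : ∀ {p} → Prime p → p ℕ.∣ N → ¬ (+ p ∣ b)
    prime∣N⇒∤b {p} p-prime p∣N p∣b =
      let m , collision = no-collision p-prime p∣N
          p∣a           = ∣ᵤ⇒∣ {+ p} {+ a} (prime∣N⇒∣a p-prime p∣N)
      in collision 0ℤ
        (∣m∣n⇒∣m+n {+ p} {+ a * (+ 2 * 0ℤ + m)} {b} (∣m⇒∣m*n {+ p} {+ a} (+ 2 * 0ℤ + m) p∣a) p∣b)

    coprime-b : Coprime N ℤ.∣ b ∣
    coprime-b {d} (d∣N , d∣b) with d ℕ.≟ 1
    ... | yes d≡1 = d≡1
    ... | no  d≢1 = contradiction
      (∣ᵤ⇒∣ (ℕ.∣-trans p∣d d∣b)) (prime∣N⇒∤b p-prime (ℕ.∣-trans p∣d d∣N))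
      where
      d≢0 : NonZero d
      d≢0 = ℕ.≢-nonZero λ { refl → ℕ.≢-nonZero⁻¹ N (ℕ.0∣⇒≡0 d∣N) }
      primeDivisor : ∃[ p ] Prime p × p ℕ.∣ d
      primeDivisor = ∃-primeDivisor d {{d≢0}} d≢1
      p-prime : Prime (proj₁ primeDivisor)
      p-prime = proj₁ (proj₂ primeDivisor)
      p∣d : proj₁ primeDivisor ℕ.∣ d
      p∣d = proj₂ (proj₂ primeDivisor)

    coprime-2 : Coprime N 2
    coprime-2 = prime∧∤⇒coprime prime[2] 2∤N

    -- Here 9 ∤ N is decisive. If 3 ∣ N, then also 3 ∣ a; with N = 3m and a = 3k the hypothesis
    -- becomes m ∣ 3k, and m is prime to 3. Otherwise 3 is invertible modulo N.
    N∣3a⇒N∣a : + N ∣ + 3 * + a → N ℕ.∣ a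
    N∣3a⇒N∣a N∣3a with 3 ℕ.∣? N
    ... | no  3∤N = ∣⇒∣ᵤ (coprime-cancel (+ 3) (+ a) (prime∧∤⇒coprime prime[3] 3∤N) N∣3a)
    ... | yes 3∣N@(ℕ.divides m refl) with prime∣N⇒∣a prime[3] 3∣N
    ...   | ℕ.divides k refl = ℕ.*-monoˡ-∣ 3 m∣k
      where
      m∣3k : m ℕ.∣ 3 ℕ.* k
      m∣3k = ℕ.*-cancelˡ-∣ 3 (subst₂ ℕ._∣_ (ℕ.*-comm m 3) (cong (3 ℕ.*_) (ℕ.*-comm k 3))
        (subst (m ℕ.* 3 ℕ.∣_) (ℤ.abs-* (+ 3) (+ (k ℕ.* 3))) (∣⇒∣ᵤ N∣3a)))
        where open ≡ using (subst₂)
      3∤m : ¬ (3 ℕ.∣ m)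
      3∤m 3∣m = 9∤N (ℕ.*-monoˡ-∣ 3 3∣m)
      m∣k : m ℕ.∣ k
      m∣k = ℕ.coprime-divisor (prime∧∤⇒coprime prime[3] 3∤m) m∣3k

    -- As 24 = 8 · 3 and both 36 and 12 are multiples of 4 · 3, cancelling the units 2 and u leaves
    -- N ∣ 3a² and N ∣ 9a² + 3ab. The first absorbs 9a², and then the unit b cancels from 3ab.
    differences⇒N∣a : ∀ u → Coprime N ℤ.∣ u ∣ →
      + N ∣ + 24 * (u * (+ a * + a)) →
      + N ∣ + 36 * (u * (+ a * + a)) + + 12 * (u * (+ a * b)) →
      N ℕ.∣ a
    differences⇒N∣a u coprime-u N∣Δ⁴ N∣Δ³ = N∣3a⇒N∣a (coprime-cancel b (+ 3 * + a) coprime-b N∣3ab)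
      where
      cancel-2 : ∀ i → + N ∣ + 2 * i → + N ∣ i
      cancel-2 i = coprime-cancel (+ 2) i coprime-2
      lemma₄ : ∀ u a → + 24 * (u * (a * a)) ≡ + 2 * (+ 2 * (+ 2 * (u * (+ 3 * (a * a)))))
      lemma₄ = solve-∀
      lemma₃ : ∀ u a b → + 36 * (u * (a * a)) + + 12 * (u * (a * b)) ≡
                         + 2 * (+ 2 * (u * (+ 3 * (+ 3 * (a * a)) + b * (+ 3 * a))))
      lemma₃ = solve-∀
      N∣3a² : + N ∣ + 3 * (+ a * + a)
      N∣3a² = coprime-cancel u _ coprime-u (cancel-2 _ (cancel-2 _ (cancel-2 _
        (subst (+ N ∣_) (lemma₄ u (+ a)) N∣Δ⁴))))
      N∣3ab : + N ∣ b * (+ 3 * + a)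
      N∣3ab = ∣m+n∣m⇒∣n (coprime-cancel u _ coprime-u (cancel-2 _ (cancel-2 _
        (subst (+ N ∣_) (lemma₃ u (+ a) b) N∣Δ³)))) (∣n⇒∣m*n (+ 3) N∣3a²)

    N∤a⇒∃-squareDivisor : ¬ (N ℕ.∣ a) → ∃[ p ] Prime p × 5 ℕ.≤ p × p ℕ.^ 2 ℕ.∣ N
    N∤a⇒∃-squareDivisor N∤a with ℕ.gcd[m,n]∣n a N
    ... | ℕ.divides m N≡mg = p , p-prime , 5≤ p p-prime p²∣N , p²∣N
      where
      m≢0 : NonZero m
      m≢0 = ℕ.≢-nonZero λ { refl → ℕ.≢-nonZero⁻¹ N N≡mg }
      m≢1 : m ≢ 1
      m≢1 refl = N∤a (subst (ℕ._∣ a) (sym (trans N≡mg (ℕ.*-identityˡ _))) (ℕ.gcd[m,n]∣m a N))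
      primeDivisor : ∃[ p ] Prime p × p ℕ.∣ m
      primeDivisor = ∃-primeDivisor m {{m≢0}} m≢1
      p : ℕ
      p = proj₁ primeDivisor
      p-prime : Prime p
      p-prime = proj₁ (proj₂ primeDivisor)
      p∣m : p ℕ.∣ m
      p∣m = proj₂ (proj₂ primeDivisor)
      p∣N : p ℕ.∣ N
      p∣N = ℕ.∣-trans p∣m (subst (m ℕ.∣_) (sym N≡mg) (ℕ.m∣m*n (ℕ.gcd a N)))
      -- In N = m · gcd(a, N) the prime divides both factors: m by choice, the gcd because it
      -- divides a and N.
      p²∣N : p ℕ.^ 2 ℕ.∣ N
      p²∣N = subst₂ ℕ._∣_ (cong (p ℕ.*_) (sym (ℕ.*-identityʳ p))) (sym N≡mg)
        (ℕ.*-pres-∣ p∣m (ℕ.gcd-greatest (prime∣N⇒∣a p-prime p∣N) p∣N))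
        where open ≡ using (subst₂)
      -- The values 2, 3 and 4 are excluded by what p² ∣ N entails: 2 ∣ N, 9 ∣ N and again 2 ∣ N.
      5≤ : ∀ p → Prime p → p ℕ.^ 2 ℕ.∣ N → 5 ℕ.≤ p
      5≤ 0 0-prime _ = contradiction 0-prime ¬prime[0]
      5≤ 1 1-prime _ = contradiction 1-prime ¬prime[1]
      5≤ 2 _ 4∣N = contradiction (ℕ.∣-trans (ℕ.divides 2 refl) 4∣N) 2∤N
      5≤ 3 _ 9∣N = contradiction 9∣N 9∤N
      5≤ 4 _ 16∣N = contradiction (ℕ.∣-trans (ℕ.divides 8 refl) 16∣N) 2∤N
      5≤ (suc (suc (suc (suc (suc p))))) _ _ = ℕ.s≤s (ℕ.s≤s (ℕ.s≤s (ℕ.s≤s (ℕ.s≤s ℕ.z≤n))))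

  -- Parity, divisibility by three, and finite differences

  2∣k[k+1] : ∀ k → ∃[ e ] k * (k + 1ℤ) ≡ + 2 * e
  2∣k[k+1] k with k %ℕ 2 | k /ℕ′ 2 | n%ℕd<d k 2 | a≡a%ℕn+[a/ℕn]*n k 2
  ... | 0 | q | _ | refl = _ , lemma q
    where
    lemma : ∀ q → (+ 0 + q * + 2) * (+ 0 + q * + 2 + 1ℤ) ≡ + 2 * (q * (q * + 2 + 1ℤ))
    lemma = solve-∀
  ... | 1 | q | _ | refl = _ , lemma q
    where
    lemma : ∀ q → (+ 1 + q * + 2) * (+ 1 + q * + 2 + 1ℤ) ≡ + 2 * ((+ 1 + q * + 2) * (q + 1ℤ))
    lemma = solve-∀
  ... | suc (suc _) | q | ℕ.s≤s (ℕ.s≤s ()) | _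

  -- This and the parity lemma are equations with a witness, so that they can be substituted into an
  -- exponent before the ring solver normalises it.
  3∣k³-k : ∀ k → ∃[ e ] k * k * k - k ≡ + 3 * e
  3∣k³-k k with k %ℕ 3 | k /ℕ′ 3 | n%ℕd<d k 3 | a≡a%ℕn+[a/ℕn]*n k 3
  ... | 0 | q | _ | refl = _ , lemma q
    where
    lemma : ∀ q → let k = + 0 + q * + 3 in k * k * k - k ≡ + 3 * (q * (k * k - 1ℤ))
    lemma = solve-∀
  ... | 1 | q | _ | refl = _ , lemma q
    where
    lemma : ∀ q → let k = + 1 + q * + 3 in k * k * k - k ≡ + 3 * (k * (k + 1ℤ) * q)
    lemma = solve-∀
  ... | 2 | q | _ | refl = _ , lemma q
    where
    lemma : ∀ q → let k = + 2 + q * + 3 in k * k * k - k ≡ + 3 * (k * (k - 1ℤ) * (q + 1ℤ))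
    lemma = solve-∀
  ... | suc (suc (suc _)) | q | ℕ.s≤s (ℕ.s≤s (ℕ.s≤s ())) | _

  odd⇒%2≡1 : ∀ {n} → ¬ (2 ℕ.∣ n) → n ℕ.% 2 ≡ 1
  odd⇒%2≡1 {n} 2∤n with n ℕ.% 2 in eq | ℕ.m%n<n n 2
  ... | 0           | _ = contradiction (ℕ.m%n≡0⇒n∣m n 2 eq) 2∤n
  ... | 1           | _ = refl
  ... | suc (suc _) | ℕ.s≤s (ℕ.s≤s ())

  odd⇒1+2t : ∀ {n} → ¬ (2 ℕ.∣ n) → ∃[ t ] + n ≡ 1ℤ + + 2 * t
  odd⇒1+2t {n} 2∤n = + (n ℕ./ 2) , (begin
    + n                                    ≡⟨ cong +_ (ℕ.m≡m%n+[m/n]*n n 2) ⟩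
    + (n ℕ.% 2 ℕ.+ n ℕ./ 2 ℕ.* 2)          ≡⟨ cong (λ r → + (r ℕ.+ n ℕ./ 2 ℕ.* 2)) (odd⇒%2≡1 2∤n) ⟩
    1ℤ + + (n ℕ./ 2 ℕ.* 2)                 ≡⟨ cong (λ i → 1ℤ + i) (ℤ.pos-* (n ℕ./ 2) 2) ⟩
    1ℤ + + (n ℕ./ 2) * + 2                 ≡⟨ cong (λ i → 1ℤ + i) (ℤ.*-comm (+ (n ℕ./ 2)) (+ 2)) ⟩
    1ℤ + + 2 * + (n ℕ./ 2)                 ∎)
    where open ≡.≡-Reasoning

  -- The weights 1, -4, 6, -4 are those of Δ⁴ at 0, to be applied to d_j = G(j) - G(0); the fifth
  -- term d₀ is 0.
  fourth-difference : ∀ {n d₁ d₂ d₃ d₄} → n ∣ d₁ → n ∣ d₂ → n ∣ d₃ → n ∣ d₄ →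
                      n ∣ d₄ - + 4 * d₃ + + 6 * d₂ - + 4 * d₁
  fourth-difference {n} (divides q₁ refl) (divides q₂ refl) (divides q₃ refl) (divides q₄ refl) =
    divides (q₄ - + 4 * q₃ + + 6 * q₂ - + 4 * q₁) (lemma n q₁ q₂ q₃ q₄)
    where
    lemma : ∀ n q₁ q₂ q₃ q₄ → q₄ * n - + 4 * (q₃ * n) + + 6 * (q₂ * n) - + 4 * (q₁ * n) ≡
                              (q₄ - + 4 * q₃ + + 6 * q₂ - + 4 * q₁) * n
    lemma = solve-∀

  third-difference : ∀ {n d₁ d₂ d₃} → n ∣ d₁ → n ∣ d₂ → n ∣ d₃ → n ∣ d₃ - + 3 * d₂ + + 3 * d₁
  third-difference {n} (divides q₁ refl) (divides q₂ refl) (divides q₃ refl) =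
    divides (q₃ - + 3 * q₂ + + 3 * q₁) (lemma n q₁ q₂ q₃)
    where
    lemma : ∀ n q₁ q₂ q₃ → q₃ * n - + 3 * (q₂ * n) + + 3 * (q₁ * n) ≡
                           (q₃ - + 3 * q₂ + + 3 * q₁) * n
    lemma = solve-∀

  -- Chirps and their invariance under equivalence

  module Chirps {c ℓ₁ ℓ₂ ℓ₃} {ℝ : RealNumbers c ℓ₁ ℓ₂ ℓ₃}
                (T : Trigonometry ℝ) (N : ℕ) .{{_ : NonZero N}} where
    open Complex T
    open ComplexProperties T
    open Residues N
    open ResidueProperties N
    open Congruence (+ N)
    open Sequences T N
    open RootsOfUnity T N
    open import Relation.Binary.Reasoning.Setoid ℂ-setoid

    -- `z` absorbs the constants that scalings and shifts produce, and it disappears when two values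
    -- are compared.
    Chirp : Sequence → Set (c ⊔ ℓ₁)
    Chirp s = ∃[ z ] ∃₂ λ α β → ∀ k → s k ≈ᶜ z *ᶜ W ^ᶜ quad α β (repr k)

    W-≡ : ∀ {i j} → i ≡ j → W ^ᶜ i ≈ᶜ W ^ᶜ j
    W-≡ i≡j = reflexiveᶜ (cong (W ^ᶜ_) i≡j)

    -- Shift and decimation are both affine changes of index k ↦ pk + q. Expanding the quadratic at
    -- pk + q gives the new coefficients, and its constant term moves into `z`.
    chirp-reparametrise : ∀ {s s′} (σ : ℤ/N → ℤ/N) p q →
      (∀ k → s k ≈ᶜ s′ (σ k)) → (∀ k → repr (σ k) ≋ p * repr k + q) → Chirp s′ → Chirp s
    chirp-reparametrise {s} {s′} σ p q s≈s′∘σ σ≋ (z , α , β , s′≈) =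
      z *ᶜ W ^ᶜ quad α β q , α * (p * p) , + 2 * α * p * q + β * p , λ k → begin
        s k                                                 ≈⟨ s≈s′∘σ k ⟩
        s′ (σ k)                                            ≈⟨ s′≈ (σ k) ⟩
        z *ᶜ W ^ᶜ quad α β (repr (σ k))                     ≈⟨ *ᶜ-congˡ (W-cong (quad α β (repr (σ k))) (quad α β (p * repr k + q)) (difference (quad-congˣ α β (σ≋ k)))) ⟩
        z *ᶜ W ^ᶜ quad α β (p * repr k + q)                 ≈⟨ *ᶜ-congˡ (W-≡ (lemma α β p q (repr k))) ⟩
        z *ᶜ W ^ᶜ (quad α β q + quad (α * (p * p)) (+ 2 * α * p * q + β * p) (repr k))
          ≈⟨ *ᶜ-congˡ (W-+ (quad α β q) (quad (α * (p * p)) (+ 2 * α * p * q + β * p) (repr k))) ⟩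
        z *ᶜ (W ^ᶜ quad α β q *ᶜ W ^ᶜ quad (α * (p * p)) (+ 2 * α * p * q + β * p) (repr k))
          ≈⟨ symᶜ (*ᶜ-assoc _ _ _) ⟩
        z *ᶜ W ^ᶜ quad α β q *ᶜ W ^ᶜ quad (α * (p * p)) (+ 2 * α * p * q + β * p) (repr k) ∎
      where
      lemma : ∀ α β p q k → α * ((p * k + q) * (p * k + q)) + β * (p * k + q) ≡
        (α * (q * q) + β * q) + (α * (p * p) * (k * k) + (+ 2 * α * p * q + β * p) * k)
      lemma = solve-∀

    -- The chain of operations ends at the Zadoff-Chu sequence, so being a chirp travels against the
    -- arrows and each case undoes its operation: `conj w` for `w`, - d for d, r⁻¹ for r, - l for l,
    -- and conjugation by itself.
    chirp-↝ : ∀ {s s′} → s ↝ s′ → Chirp s′ → Chirp s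
    chirp-↝ {s} {s′} (scale w |w|≈1 s′≈ws) (z , α , β , s′≈) =
      conj w *ᶜ z , α , β , λ k → begin
        s k                                          ≈⟨ symᶜ (*ᶜ-identityˡ (s k)) ⟩
        1ᶜ *ᶜ s k                                    ≈⟨ *ᶜ-congʳ (symᶜ (unimodular⇒inverse′ |w|≈1)) ⟩
        (conj w *ᶜ w) *ᶜ s k                         ≈⟨ *ᶜ-assoc _ _ _ ⟩
        conj w *ᶜ (w *ᶜ s k)                         ≈⟨ *ᶜ-congˡ (symᶜ (s′≈ws k)) ⟩
        conj w *ᶜ s′ k                               ≈⟨ *ᶜ-congˡ (s′≈ k) ⟩
        conj w *ᶜ (z *ᶜ W ^ᶜ quad α β (repr k))      ≈⟨ symᶜ (*ᶜ-assoc _ _ _) ⟩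
        conj w *ᶜ z *ᶜ W ^ᶜ quad α β (repr k)        ∎
    chirp-↝ {s} {s′} (shift d s′≈) = chirp-reparametrise {s} {s′} σ 1ℤ (- repr d)
      (λ k → begin
        s k               ≈⟨ reflexiveᶜ (cong s (sym (σ-shift k))) ⟩
        s (σ k ⊕ d)       ≈⟨ symᶜ (s′≈ (σ k)) ⟩
        s′ (σ k)          ∎)
      σ≋
      where
      σ : ℤ/N → ℤ/N
      σ k = residue (1ℤ * repr k + - repr d)
      σ≋ : ∀ k → repr (σ k) ≋ 1ℤ * repr k + - repr d
      σ≋ k = repr-residue _
      lemma : ∀ k d → 1ℤ * k + - d + d ≡ k
      lemma = solve-∀
      σ-shift : ∀ k → σ k ⊕ d ≡ k
      σ-shift k = repr-injective (≋-trans (repr-⊕ (σ k) d)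
        (≋-trans (+-cong (σ≋ k) ≋-refl) (≋-reflexive (lemma (repr k) (repr d)))))
    chirp-↝ {s} {s′} (decimate r (r⁻¹ , _ , rr⁻¹≡1) s′≈) = chirp-reparametrise {s} {s′} (r⁻¹ ⊗_) (repr r⁻¹) 0ℤ
      (λ k → begin
        s k                  ≈⟨ reflexiveᶜ (cong s (sym (inverse k))) ⟩
        s (r ⊗ (r⁻¹ ⊗ k))    ≈⟨ symᶜ (s′≈ (r⁻¹ ⊗ k)) ⟩
        s′ (r⁻¹ ⊗ k)         ∎)
      (λ k → ≋-trans (repr-⊗ r⁻¹ k) (≋-reflexive (sym (ℤ.+-identityʳ _))))
      where
      rr⁻¹≋1 : repr r * repr r⁻¹ ≋ 1ℤ
      rr⁻¹≋1 = residue-injective rr⁻¹≡1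
      inverse : ∀ k → r ⊗ (r⁻¹ ⊗ k) ≡ k
      inverse k = repr-injective (≋-trans (repr-⊗ r (r⁻¹ ⊗ k)) (≋-trans
        (*-congˡ (repr r) (repr-⊗ r⁻¹ k)) (≋-trans
        (≋-reflexive (sym (ℤ.*-assoc (repr r) (repr r⁻¹) (repr k)))) (≋-trans
        (*-cong rr⁻¹≋1 (≋-refl {repr k})) (≋-reflexive (ℤ.*-identityˡ (repr k)))))))
    chirp-↝ {s} {s′} (modulate l s′≈Ws) (z , α , β , s′≈) =
      z , α , β - repr l , λ k → let L = repr l * repr k ; Q = quad α β (repr k) in begin
        s k                                       ≈⟨ symᶜ (*ᶜ-identityˡ (s k)) ⟩
        1ᶜ *ᶜ s k                                 ≈⟨ *ᶜ-congʳ (W-≡ (sym (ℤ.+-inverseˡ L))) ⟩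
        W ^ᶜ (- L + L) *ᶜ s k                     ≈⟨ *ᶜ-congʳ (W-+ (- L) L) ⟩
        W ^ᶜ (- L) *ᶜ W ^ᶜ L *ᶜ s k               ≈⟨ *ᶜ-assoc _ _ _ ⟩
        W ^ᶜ (- L) *ᶜ (W ^ᶜ L *ᶜ s k)             ≈⟨ *ᶜ-congˡ (symᶜ (s′≈Ws k)) ⟩
        W ^ᶜ (- L) *ᶜ s′ k                        ≈⟨ *ᶜ-congˡ (s′≈ k) ⟩
        W ^ᶜ (- L) *ᶜ (z *ᶜ W ^ᶜ Q)               ≈⟨ *ᶜ-x∙yz≈y∙xz _ _ _ ⟩
        z *ᶜ (W ^ᶜ (- L) *ᶜ W ^ᶜ Q)               ≈⟨ *ᶜ-congˡ (symᶜ (W-+ (- L) Q)) ⟩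
        z *ᶜ W ^ᶜ (- L + Q)                       ≈⟨ *ᶜ-congˡ (W-≡ (lemma α β (repr l) (repr k))) ⟩
        z *ᶜ W ^ᶜ quad α (β - repr l) (repr k)    ∎
      where
      lemma : ∀ α β l k → - (l * k) + (α * (k * k) + β * k) ≡ α * (k * k) + (β - l) * k
      lemma = solve-∀
    chirp-↝ {s} {s′} (conjugate s′≈conj) (z , α , β , s′≈) =
      conj z , - α , - β , λ k → begin
        s k                                              ≈⟨ symᶜ (conj-involutive (s k)) ⟩
        conj (conj (s k))                                ≈⟨ conj-cong (symᶜ (s′≈conj k)) ⟩
        conj (s′ k)                                      ≈⟨ conj-cong (s′≈ k) ⟩
        conj (z *ᶜ W ^ᶜ quad α β (repr k))               ≈⟨ conj-* _ _ ⟩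
        conj z *ᶜ conj (W ^ᶜ quad α β (repr k))          ≈⟨ *ᶜ-congˡ (conj-^ᶜ W (quad α β (repr k))) ⟩
        conj z *ᶜ W ^ᶜ (- quad α β (repr k))             ≈⟨ *ᶜ-congˡ (W-≡ (lemma α β (repr k))) ⟩
        conj z *ᶜ W ^ᶜ quad (- α) (- β) (repr k)         ∎
      where
      lemma : ∀ α β k → - (α * (k * k) + β * k) ≡ - α * (k * k) + - β * k
      lemma = solve-∀

    chirp-~ : ∀ {s s′} → s ~ s′ → Chirp s′ → Chirp s
    chirp-~ ε            chirp = chirp
    chirp-~ (step ◅ eqv) chirp = chirp-↝ step (chirp-~ eqv chirp)

    -- With N = 1 + 2h, the exponent E = u (k + 1 + 2q) k of ζ is even, so that
    -- ζ^E = ζ^((N+1)E) = W^((h+1)E).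
    zadoffChu-chirp : ¬ (2 ℕ.∣ N) → ∀ u q → Chirp (zadoffChu u q)
    zadoffChu-chirp 2∤N u q with odd⇒1+2t 2∤N
    ... | h , N≡1+2h = 1ᶜ , α , β , λ k → begin
        ζ ^ᶜ (u * (repr k + + (N ℕ.% 2) + + 2 * q) * repr k)
          ≈⟨ reflexiveᶜ (cong (λ r → ζ ^ᶜ (u * (repr k + + r + + 2 * q) * repr k)) (odd⇒%2≡1 2∤N)) ⟩
        ζ ^ᶜ (u * (repr k + 1ℤ + + 2 * q) * repr k)
          ≈⟨ ζ-cong (u * (repr k + 1ℤ + + 2 * q) * repr k) (quad α β (repr k) * + 2) (exponents (repr k)) ⟩
        ζ ^ᶜ (quad α β (repr k) * + 2)
          ≈⟨ symᶜ (W-ζ (quad α β (repr k))) ⟩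
        W ^ᶜ quad α β (repr k)
          ≈⟨ symᶜ (*ᶜ-identityˡ _) ⟩
        1ᶜ *ᶜ W ^ᶜ quad α β (repr k) ∎
      where
      α β : ℤ
      α = (h + 1ℤ) * u
      β = (h + 1ℤ) * u * (1ℤ + + 2 * q)
      lemma₁ : ∀ u q h k →
        u * (k + 1ℤ + + 2 * q) * k -
          ((h + 1ℤ) * u * (k * k) + (h + 1ℤ) * u * (1ℤ + + 2 * q) * k) * + 2 ≡
        - (u * (k * (k + 1ℤ) + + 2 * q * k)) * (1ℤ + + 2 * h)
      lemma₁ = solve-∀
      lemma₂ : ∀ u q k e n → - (u * (+ 2 * e + + 2 * q * k)) * n ≡ - (u * (e + q * k)) * (n + n)
      lemma₂ = solve-∀
      exponents : ∀ k → + (N ℕ.+ N) ∣ u * (k + 1ℤ + + 2 * q) * k - quad α β k * + 2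
      exponents k with 2∣k[k+1] k
      ... | e , k[k+1]≡2e = divides (- (u * (e + q * k)))
        (trans (lemma₁ u q h k) (trans (≡.cong₂ (λ x n → - (u * (x + + 2 * q * k)) * n) k[k+1]≡2e (sym N≡1+2h))
          (lemma₂ u q k e (+ N))))

    -- If G is constant mod N, then so are its differences at 0, which isolate the
    -- coefficients of x⁴ and x³.
    chirp⇒differences : ∀ a b u q → Chirp (zadoffChu u q ∘ quadratic a b) →
      + N ∣ + 24 * (u * (repr a * repr a)) ×
      + N ∣ + 36 * (u * (repr a * repr a)) + + 12 * (u * (repr a * repr b))
    chirp⇒differences a b u q (z , α , β , chirp) =
        subst (+ N ∣_) (lemma₄ u w α β (repr a) (repr b))
          (fourth-difference (G-constant (+ 1)) (G-constant (+ 2)) (G-constant (+ 3)) (G-constant (+ 4)))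
      , subst (+ N ∣_) (lemma₃ u w α β (repr a) (repr b))
          (third-difference (G-constant (+ 1)) (G-constant (+ 2)) (G-constant (+ 3)))
      where
      w : ℤ
      w = + (N ℕ.% 2) + + 2 * q
      g : ℤ/N → ℤ
      g k = u * (repr (quadratic a b k) + + (N ℕ.% 2) + + 2 * q) * repr (quadratic a b k)
      Q : ℤ → ℤ
      Q x = quad α β x * + 2
      G : ℤ → ℤ
      G x = u * (quad (repr a) (repr b) x + w) * quad (repr a) (repr b) x - Q x
      ζ^[g-Q]≈z : ∀ k → ζ ^ᶜ (g k - Q (repr k)) ≈ᶜ z
      ζ^[g-Q]≈z k = begin
        ζ ^ᶜ (g k - q′)                        ≈⟨ ζ-+ (g k) (- q′) ⟩
        ζ ^ᶜ g k *ᶜ ζ ^ᶜ (- q′)                ≈⟨ *ᶜ-congʳ (chirp k) ⟩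
        z *ᶜ W ^ᶜ quad α β (repr k) *ᶜ ζ ^ᶜ (- q′)
          ≈⟨ *ᶜ-congʳ (*ᶜ-congˡ (W-ζ (quad α β (repr k)))) ⟩
        z *ᶜ ζ ^ᶜ q′ *ᶜ ζ ^ᶜ (- q′)            ≈⟨ *ᶜ-assoc _ _ _ ⟩
        z *ᶜ (ζ ^ᶜ q′ *ᶜ ζ ^ᶜ (- q′))          ≈⟨ *ᶜ-congˡ (symᶜ (ζ-+ q′ (- q′))) ⟩
        z *ᶜ ζ ^ᶜ (q′ - q′)                    ≈⟨ *ᶜ-congˡ (reflexiveᶜ (cong (ζ ^ᶜ_) (ℤ.+-inverseʳ q′))) ⟩
        z *ᶜ 1ᶜ                                ≈⟨ *ᶜ-identityʳ z ⟩
        z                                      ∎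
        where
        q′ : ℤ
        q′ = Q (repr k)
      -- Constancy modulo 2N is weakened to N here, because the passage from least residues to the
      -- integer polynomial `G` is controlled only modulo N.
      N∣2N : + N ∣ + (N ℕ.+ N)
      N∣2N = ∣ᵤ⇒∣ (ℕ.∣m∣n⇒∣m+n ℕ.∣-refl ℕ.∣-refl)
      g-Q-constant : ∀ j k → g j - Q (repr j) ≋ g k - Q (repr k)
      g-Q-constant j k = congruent (∣-trans N∣2N (ζ-injective (g j - Q (repr j)) (g k - Q (repr k))
        (transᶜ {ζ ^ᶜ (g j - Q (repr j))} {z} {ζ ^ᶜ (g k - Q (repr k))} (ζ^[g-Q]≈z j) (symᶜ (ζ^[g-Q]≈z k)))))
      g-Q≋G : ∀ x → g (residue x) - Q (repr (residue x)) ≋ G x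
      g-Q≋G x = +-cong
        (*-cong (*-congˡ u (≋-trans (≋-reflexive (ℤ.+-assoc Π (+ (N ℕ.% 2)) (+ 2 * q))) (+-cong Π≋ (≋-refl {w})))) Π≋)
        (neg-cong (*-cong (quad-congˣ α β (repr-residue x)) (≋-refl {+ 2})))
        where
        Π : ℤ
        Π = repr (quadratic a b (residue x))
        Π≋ : Π ≋ quad (repr a) (repr b) x
        Π≋ = ≋-trans (repr-quadratic a b (residue x)) (quad-congˣ (repr a) (repr b) (repr-residue x))
      G-constant : ∀ x → + N ∣ G x - G 0ℤ
      G-constant x = difference (≋-trans (≋-sym (g-Q≋G x))
        (≋-trans (g-Q-constant (residue x) (residue 0ℤ)) (g-Q≋G 0ℤ)))
      -- All of `G` except u π² has degree at most 2 and is killed by both differences. The top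
      -- coefficients of u π² are ua² and 2uab, whence 24 = 4!, 36 = Δ³x⁴ at 0, and 12 = 2 · 3!.
      lemma₄ : ∀ u w α β a b →
        let G = λ x → u * (a * (x * x) + b * x + w) * (a * (x * x) + b * x) - (α * (x * x) + β * x) * + 2 in
        G (+ 4) - G 0ℤ - + 4 * (G (+ 3) - G 0ℤ) + + 6 * (G (+ 2) - G 0ℤ) - + 4 * (G (+ 1) - G 0ℤ) ≡
        + 24 * (u * (a * a))
      lemma₄ = solve-∀
      lemma₃ : ∀ u w α β a b →
        let G = λ x → u * (a * (x * x) + b * x + w) * (a * (x * x) + b * x) - (α * (x * x) + β * x) * + 2 in
        G (+ 3) - G 0ℤ - + 3 * (G (+ 2) - G 0ℤ) + + 3 * (G (+ 1) - G 0ℤ) ≡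
        + 36 * (u * (a * a)) + + 12 * (u * (a * b))
      lemma₃ = solve-∀

  -- By 3 ∣ k³ − k and 2 ∣ k⁴ − k².
  6A∣π[π-A]-k[k+A] : ∀ A m k π → A ≡ m * + 3 → + 3 * A ∣ π - quad A 1ℤ k →
                     + 3 * A + + 3 * A ∣ (π - A) * π - (k + A) * k
  6A∣π[π-A]-k[k+A] A m k π A≡m*3 (divides s π-P≡sN) = divides quotient (begin
    (π - A) * π - (k + A) * k
      ≡⟨ cong (λ x → (x - A) * x - (k + A) * k) π≡ ⟩
    (P + s * (+ 3 * A) - A) * (P + s * (+ 3 * A)) - (k + A) * k
      ≡⟨ lemma₁ A k s ⟩
    F (s * (s + 1ℤ)) (k * k * k - k) A (k * (k + 1ℤ))
      ≡⟨ F-cong (s * (s + 1ℤ)) (+ 2 * eₛ) (k * k * k - k) (+ 3 * e₃) A (m * + 3) (k * (k + 1ℤ)) (+ 2 * e)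
           (proj₂ (2∣k[k+1] s)) (proj₂ (3∣k³-k k)) A≡m*3 (proj₂ (2∣k[k+1] k)) ⟩
    F (+ 2 * eₛ) (+ 3 * e₃) (m * + 3) (+ 2 * e)
      ≡⟨ lemma₂ A k s P m eₛ e₃ e ⟩
    quotient * (+ 3 * A + + 3 * A) ∎)
    where
    open ≡.≡-Reasoning
    P e eₛ e₃ quotient : ℤ
    P = quad A 1ℤ k
    e  = proj₁ (2∣k[k+1] k)
    eₛ = proj₁ (2∣k[k+1] s)
    e₃ = proj₁ (3∣k³-k k)
    -- The summands follow the four terms of `F`: the first term has the factor 6A already; in the
    -- others it is completed by 2 ∣ s (s + 1), by 3 ∣ k³ - k, and by 3 ∣ A together with 2 ∣ k (k +
    -- 1).
    quotient = P * s + A * (s * s - s) + A * eₛ + e₃ + m * (k * (k - 1ℤ)) * e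
    split : ∀ i j → i ≡ j + (i - j)
    split = solve-∀
    π≡ : π ≡ P + s * (+ 3 * A)
    π≡ = trans (split π P) (cong (λ i → P + i) π-P≡sN)
    lemma₁ : ∀ A k s → let P = A * (k * k) + 1ℤ * k in
      (P + s * (+ 3 * A) - A) * (P + s * (+ 3 * A)) - (k + A) * k ≡
      (P * s + A * (s * s - s)) * (+ 3 * A + + 3 * A) + A * (s * (s + 1ℤ)) * (+ 3 * A) +
        + 2 * A * (k * k * k - k) + A * A * (k * (k - 1ℤ)) * (k * (k + 1ℤ))
    lemma₁ = solve-∀
    lemma₂ : ∀ A k s P m eₛ e₃ e →
      (P * s + A * (s * s - s)) * (+ 3 * A + + 3 * A) + A * (+ 2 * eₛ) * (+ 3 * A) +
        + 2 * A * (+ 3 * e₃) + A * (m * + 3) * (k * (k - 1ℤ)) * (+ 2 * e) ≡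
      (P * s + A * (s * s - s) + A * eₛ + e₃ + m * (k * (k - 1ℤ)) * e) * (+ 3 * A + + 3 * A)
    lemma₂ = solve-∀
    -- The expressions to be rewritten are abstracted for simultaneous replacement. Of all
    -- occurrences of A only one, inside A², is to become 3m; the others must stay to form the
    -- modulus 6A.
    F : ℤ → ℤ → ℤ → ℤ → ℤ
    F x y z w = (P * s + A * (s * s - s)) * (+ 3 * A + + 3 * A) + A * x * (+ 3 * A) +
      + 2 * A * y + A * z * (k * (k - 1ℤ)) * w
    F-cong : ∀ x x′ y y′ z z′ w w′ → x ≡ x′ → y ≡ y′ → z ≡ z′ → w ≡ w′ → F x y z w ≡ F x′ y′ z′ w′
    F-cong x x′ y y′ z z′ w w′ refl refl refl refl = refl

  -- The two implications

  module Equivalences {c ℓ₁ ℓ₂ ℓ₃} {ℝ : RealNumbers c ℓ₁ ℓ₂ ℓ₃}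
                      (T : Trigonometry ℝ) (N : ℕ) .{{_ : NonZero N}} where
    open Complex T
    open ComplexProperties T
    open Residues N
    open ResidueProperties N
    open Congruence (+ N)
    open Sequences T N
    open RootsOfUnity T N
    open Chirps T N

    -- Pointwise equal sequences need not be identical as functions, so the empty chain does not
    -- relate them; scaling by 1 does.
    ≈⇒~ : ∀ {s s′} → (∀ k → s k ≈ᶜ s′ k) → s ~ s′
    ≈⇒~ {s} {s′} s≈s′ = scale 1ᶜ 1ᶜ-unimodular
      (λ k → transᶜ {s′ k} {s k} {1ᶜ *ᶜ s k} (symᶜ (s≈s′ k)) (symᶜ (*ᶜ-identityˡ (s k)))) ◅ ε

    coprime-1 : gcd 1ℤ (+ N) ≡ 1ℤ
    coprime-1 = gcd-zeroˡ (+ N)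

    ∣repr⇒≡0 : ∀ {a} → + N ∣ repr a → a ≡ residue 0ℤ
    ∣repr⇒≡0 N∣a = repr-injective (≋-trans (∣⇒≋0 N∣a) (≋-sym (repr-residue 0ℤ)))

    module Injective a b (ab∈𝒬 : 𝒬 a b) = InjectiveQuadratic N (toℕ a) (repr b)
      (quadratic-injective⇒quad-injective {a} {b} (proj₁ ab∈𝒬))

    -- `𝒬` is inhabited by A X² + X with A = N/p: writing N = np², one has A² = nN, while A is a
    -- proper divisor of N. So A is nilpotent and nonzero.
    arithmetic⇒inequivalent : ArithmeticCondition N → AllQuadraticsInequivalent
    arithmetic⇒inequivalent (2∤N , 9∤N , p , p-prime , _ , ℕ.divides n N≡np²) =
      (residue (+ A) , residue 1ℤ , nilpotent⇒𝒬 N∣A² N∤A) , inequivalent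
      where
      A : ℕ
      A = n ℕ.* p
      N≡Ap : N ≡ A ℕ.* p
      N≡Ap = trans N≡np² (trans (cong (λ q → n ℕ.* (p ℕ.* q)) (ℕ.*-identityʳ p)) (sym (ℕ.*-assoc n p p)))
      N∣A² : + N ∣ + A * + A
      N∣A² = divides (+ n) (begin
        + A * + A             ≡⟨ sym (ℤ.pos-* A A) ⟩
        + (A ℕ.* (n ℕ.* p))   ≡⟨ cong +_ (x∙yz≈y∙xz A n p) ⟩
        + (n ℕ.* (A ℕ.* p))   ≡⟨ ℤ.pos-* n (A ℕ.* p) ⟩
        + n * + (A ℕ.* p)     ≡⟨ cong (λ m → + n * + m) (sym N≡Ap) ⟩
        + n * + N             ∎)
        where
        open ≡.≡-Reasoning
        open import Algebra.Properties.CommutativeSemigroup ℕ.*-commutativeSemigroup using (x∙yz≈y∙xz)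
      N∤A : ¬ (+ N ∣ + A)
      N∤A N∣A = proper⇒∤ p (ℕ.nonTrivial⇒n>1 p {{prime⇒nonTrivial p-prime}}) N≡Ap (∣⇒∣ᵤ N∣A)
      inequivalent : ∀ a b → 𝒬 a b → ∀ u → gcd u (+ N) ≡ 1ℤ → ∀ q →
                     InequivalentToEveryZadoffChu (zadoffChu u q ∘ quadratic a b)
      inequivalent a b ab∈𝒬 u gcd≡1 q u′ q′ _ s~z =
        proj₂ ab∈𝒬 (∣repr⇒≡0 {a} (∣ᵤ⇒∣ {+ N} {repr a} (differences⇒N∣a u coprime-u N∣Δ⁴ N∣Δ³)))
        where
        open Injective a b ab∈𝒬 2∤N 9∤N
        coprime-u : Coprime N ℤ.∣ u ∣
        coprime-u = ℕ.sym (ℕ.gcd≡1⇒coprime (ℤ.+-injective gcd≡1))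
        differences = chirp⇒differences a b u q (chirp-~ s~z (zadoffChu-chirp 2∤N u′ q′))
        N∣Δ⁴ = proj₁ differences
        N∣Δ³ = proj₂ differences

    -- For N = 2m, the polynomial m X² + (1 − m) X induces the identity.
    inequivalent⇒odd : AllQuadraticsInequivalent → ¬ (2 ℕ.∣ N)
    inequivalent⇒odd (_ , inequivalent) (ℕ.divides m N≡m*2) =
      inequivalent a b ((injective , surjective) , residue≢0 N∤m) 1ℤ coprime-1 0ℤ 1ℤ 0ℤ coprime-1
        (≈⇒~ (λ k → reflexiveᶜ (cong (zadoffChu 1ℤ 0ℤ) (identity k))))
      where
      a b : ℤ/N
      a = residue (+ m)
      b = residue (1ℤ - + m)
      N∤m : ¬ (+ N ∣ + m)
      N∤m N∣m = proper⇒∤ 2 (ℕ.s≤s (ℕ.s≤s ℕ.z≤n)) N≡m*2 (∣⇒∣ᵤ N∣m)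
      quad≋ : ∀ k → quad (+ m) (1ℤ - + m) k ≋ k
      quad≋ k with 2∣k[k+1] k
      -- `e - k` is half of k² - k, since k² - k = k (k + 1) - 2k.
      ... | e , k[k+1]≡2e = ≋-multiple (e - k) (begin
        + m * (k * k) + (1ℤ - + m) * k - k     ≡⟨ lemma₁ (+ m) k ⟩
        + m * (k * (k + 1ℤ) - + 2 * k)         ≡⟨ cong (λ x → + m * (x - + 2 * k)) k[k+1]≡2e ⟩
        + m * (+ 2 * e - + 2 * k)              ≡⟨ lemma₂ (+ m) e k ⟩
        (e - k) * (+ m * + 2)                  ≡⟨ cong ((e - k) *_) (trans (sym (ℤ.pos-* m 2)) (cong +_ (sym N≡m*2))) ⟩
        (e - k) * + N                          ∎)
        where
        open ≡.≡-Reasoning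
        lemma₁ : ∀ m k → m * (k * k) + (1ℤ - m) * k - k ≡ m * (k * (k + 1ℤ) - + 2 * k)
        lemma₁ = solve-∀
        lemma₂ : ∀ m e k → m * (+ 2 * e - + 2 * k) ≡ (e - k) * (m * + 2)
        lemma₂ = solve-∀
      identity : ∀ k → quadratic a b k ≡ k
      identity k = repr-injective
        (≋-trans (repr-quadratic-residue (+ m) (1ℤ - + m) k) (quad≋ (repr k)))
      injective : ∀ {j k} → quadratic a b j ≡ quadratic a b k → j ≡ k
      injective {j} {k} eq = trans (sym (identity j)) (trans eq (identity k))
      surjective : ∀ k → ∃ λ j → ∀ {i} → i ≡ j → quadratic a b i ≡ k
      surjective k = k , λ { refl → identity k }

    -- For odd N = 9m and A = 3m, the permutation π = A X² + X satisfies
    -- π (π − A) ≡ X (X + A) mod 2N, because 3 ∣ X³ − X and 2 ∣ X⁴ − X².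
    inequivalent⇒9∤N : AllQuadraticsInequivalent → ¬ (9 ℕ.∣ N)
    inequivalent⇒9∤N hyp@(_ , inequivalent) (ℕ.divides m N≡m*9) =
      -- A divides the odd number N, so A = 1 + 2t. The parameters - (t + 1) and t then turn the
      -- offset 1 + 2q into - A and A, which gives the exponents π (π - A) and k (k + A).
      inequivalent a b (nilpotent⇒𝒬 N∣A² N∤A) 1ℤ coprime-1 (- (t + 1ℤ)) 1ℤ t coprime-1
        (≈⇒~ λ k → ζ-cong (exponent (- (t + 1ℤ)) (quadratic a b k)) (exponent t k) (exponents k))
      where
      A : ℕ
      A = m ℕ.* 3
      N≡A*3 : N ≡ A ℕ.* 3
      N≡A*3 = trans N≡m*9 (sym (ℕ.*-assoc m 3 3))
      a b : ℤ/N
      a = residue (+ A)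
      b = residue 1ℤ
      N∤A : ¬ (+ N ∣ + A)
      N∤A N∣A = proper⇒∤ 3 (ℕ.s≤s (ℕ.s≤s ℕ.z≤n)) N≡A*3 (∣⇒∣ᵤ N∣A)
      N≡3A : + N ≡ + 3 * + A
      N≡3A = trans (cong +_ (trans N≡A*3 (ℕ.*-comm A 3))) (ℤ.pos-* 3 A)
      N∣A² : + N ∣ + A * + A
      N∣A² = divides (+ m) (trans (cong (+ A *_) (ℤ.pos-* m 3))
        (trans (lemma (+ A) (+ m)) (cong (+ m *_) (sym N≡3A))))
        where
        lemma : ∀ A m → A * (m * + 3) ≡ m * (+ 3 * A)
        lemma = solve-∀
      2∤N : ¬ (2 ℕ.∣ N)
      2∤N = inequivalent⇒odd hyp
      2∤A : ¬ (2 ℕ.∣ A)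
      2∤A 2∣A = 2∤N (subst (2 ℕ.∣_) (sym N≡A*3) (ℕ.∣m⇒∣m*n 3 2∣A))
      t : ℤ
      t = proj₁ (odd⇒1+2t 2∤A)
      A≡1+2t : + A ≡ 1ℤ + + 2 * t
      A≡1+2t = proj₂ (odd⇒1+2t 2∤A)

      exponent : ℤ → ℤ/N → ℤ
      exponent q k = 1ℤ * (repr k + + (N ℕ.% 2) + + 2 * q) * repr k

      exponent-t : ∀ k → exponent t k ≡ (repr k + + A) * repr k
      exponent-t k = trans (cong (λ r → 1ℤ * (repr k + + r + + 2 * t) * repr k) (odd⇒%2≡1 2∤N))
        (trans (lemma (repr k) t) (cong (λ A → (repr k + A) * repr k) (sym A≡1+2t)))
        where
        lemma : ∀ k t → 1ℤ * (k + 1ℤ + + 2 * t) * k ≡ (k + (1ℤ + + 2 * t)) * k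
        lemma = solve-∀

      exponent-[-t-1] : ∀ k → exponent (- (t + 1ℤ)) k ≡ (repr k - + A) * repr k
      exponent-[-t-1] k = trans (cong (λ r → 1ℤ * (repr k + + r + + 2 * - (t + 1ℤ)) * repr k) (odd⇒%2≡1 2∤N))
        (trans (lemma (repr k) t) (cong (λ A → (repr k - A) * repr k) (sym A≡1+2t)))
        where
        lemma : ∀ k t → 1ℤ * (k + 1ℤ + + 2 * - (t + 1ℤ)) * k ≡ (k - (1ℤ + + 2 * t)) * k
        lemma = solve-∀

      exponents : ∀ k → + (N ℕ.+ N) ∣ exponent (- (t + 1ℤ)) (quadratic a b k) - exponent t k
      exponents k = ≡.subst₂ _∣_ (cong (λ n → n + n) (sym N≡3A))
        (sym (≡.cong₂ _-_ (exponent-[-t-1] (quadratic a b k)) (exponent-t k)))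
        (6A∣π[π-A]-k[k+A] (+ A) (+ m) (repr k) (repr (quadratic a b k)) (ℤ.pos-* m 3)
          (subst (_∣ repr (quadratic a b k) - quad (+ A) 1ℤ (repr k)) N≡3A
            (difference (repr-quadratic-residue (+ A) 1ℤ k))))

    -- The square divisor is extracted from the member of `𝒬` that the nonemptiness clause provides.
    -- For odd squarefree N, `𝒬` is empty and the other clause holds vacuously.
    inequivalent⇒arithmetic : AllQuadraticsInequivalent → ArithmeticCondition N
    inequivalent⇒arithmetic hyp@((a , b , ab∈𝒬) , _) = 2∤N , 9∤N , N∤a⇒∃-squareDivisor N∤a
      where
      2∤N : ¬ (2 ℕ.∣ N)
      2∤N = inequivalent⇒odd hyp
      9∤N : ¬ (9 ℕ.∣ N)
      9∤N = inequivalent⇒9∤N hyp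
      open Injective a b ab∈𝒬 2∤N 9∤N
      N∤a : ¬ (N ℕ.∣ toℕ a)
      N∤a N∣a = proj₂ ab∈𝒬 (∣repr⇒≡0 {a} (∣ᵤ⇒∣ {+ N} {repr a} N∣a))

  -- The modulus 75

  prime∣power⇒≡ : ∀ {p q} n → Prime p → Prime q → p ℕ.∣ q ^ n → p ≡ q
  prime∣power⇒≡ zero p-prime _ p∣1 = contradiction (subst Prime (ℕ.∣1⇒≡1 p∣1) p-prime) ¬prime[1]
  prime∣power⇒≡ {p} {q} (suc n) p-prime q-prime p∣q^n with euclidsLemma q (q ^ n) p-prime p∣q^n
  ... | inj₁ p∣q   = prime∣prime⇒≡ p-prime q-prime p∣q
  ... | inj₂ p∣q^n = prime∣power⇒≡ n p-prime q-prime p∣q^n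

  prime[5] : Prime 5
  prime[5] = from-yes (prime? 5)

  arithmeticCondition-75 : ArithmeticCondition 75
  arithmeticCondition-75 =
    from-no (2 ℕ.∣? 75) , from-no (9 ℕ.∣? 75) , 5 , prime[5] , ℕ.≤-refl , ℕ.divides 3 refl

  -- Both 3 and 5 divide 75, so the base of a prime power would have to equal each of them.
  ¬primePower-75 : ¬ PrimePower 75
  ¬primePower-75 (p , n , p-prime , _ , 75≡p^n) =
    contradiction (trans (prime∣power⇒≡ n prime[3] p-prime (subst (3 ℕ.∣_) 75≡p^n (ℕ.divides 25 refl)))
                         (sym (prime∣power⇒≡ n prime[5] p-prime (subst (5 ℕ.∣_) 75≡p^n (ℕ.divides 15 refl)))))
      λ ()

open import Data.Nat.Base using (_≤_; _<_; _*_; _^_)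
open ≡ using (_≡_; refl)

corollary1 : ∀ {c ℓ₁ ℓ₂ ℓ₃} {ℝ : RealNumbers c ℓ₁ ℓ₂ ℓ₃} (T : Trigonometry ℝ) →
    (∀ (N : ℕ) .{{_ : NonZero N}} → 2 ≤ N →
    Sequences.AllQuadraticsInequivalent T N ⇔ ArithmeticCondition N)
    × (75 ≡ 3 * 5 ^ 2 × ArithmeticCondition 75 × ¬ PrimePower 75)
    × (Sequences.AllQuadraticsInequivalent T 75
    × ¬ (∃₂ λ p n → Prime p × 3 < p × 1 < n × 75 ≡ p ^ n))
    × ¬ (∀ (N : ℕ) .{{_ : NonZero N}} → 2 ≤ N →
    Sequences.AllQuadraticsInequivalent T N →
    ∃₂ λ p n → Prime p × 3 < p × 1 < n × N ≡ p ^ n)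
corollary1 T =
    (λ N _ → let open Equivalences T N in mk⇔ inequivalent⇒arithmetic arithmetic⇒inequivalent)
  , (refl , arithmeticCondition-75 , ¬primePower-75)
  , (inequivalent-75 , not-power)
  , λ powers → not-power (powers 75 (ℕ.s≤s (ℕ.s≤s ℕ.z≤n)) inequivalent-75)
  where
  inequivalent-75 : Sequences.AllQuadraticsInequivalent T 75
  inequivalent-75 = Equivalences.arithmetic⇒inequivalent T 75 arithmeticCondition-75
  not-power : ¬ (∃₂ λ p n → Prime p × 3 < p × 1 < n × 75 ≡ p ^ n)
  not-power (p , n , p-prime , _ , 1<n , 75≡p^n) =
    ¬primePower-75 (p , n , p-prime , ℕ.<⇒≤ 1<n , 75≡p^n)
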